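{- Assuming the Exponential Time Hypothesis (ETH), the Minimum Membership Dominating Set (MMDS) problem does not admit an algorithm running in time $2^{o(\mathbf{vc})}\,|V|^{\mathcal{O}(1)}$, where $G=(V,E)$ is the input graph and $\mathbf{vc}$ is the size of a minimum vertex cover of $G$.
   Context: All graphs are finite, simple and undirected. For a graph $G=(V,E)$ and $v\in V$, $N[v]$ denotes the closed neighborhood of $v$. A set $S\subseteq V$ is a dominating set if every vertex of $V$ lies in $S$ or has a neighbor in $S$. For $u\in V$ and $S\subseteq V$, the membership of $u$ in $S$ is $M(u,S)=|N[u]\cap S|$. The MMDS problem: given a graph $G=(V,E)$ and a positive integer $k$, decide whether there exists a dominating set $S$ of $G$ with $\max_{u\in V} M(u,S)\le k$ (there is no bound on $|S|$). ETH asserts that 3-SAT on $n$ variables cannot be solved in time $2^{o(n)}$. -}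

module Defs where

open import Data.Bool using (Bool; true; false; if_then_else_; T; _∨_)
open import Data.Fin using (Fin; toℕ)
import Data.Fin.Properties as Fin
open import Data.Fin.Subset using (Subset; _∈_; _∩_; ∣_∣)
open import Data.List using (List; []; _∷_; map; allFin)
open import Data.List.Extrema.Nat using (max)
open import Data.List.Relation.Unary.All using (All)
open import Data.List.Relation.Unary.Unique.Propositional using (Unique)
open import Data.Nat using (ℕ; zero; suc; _+_; _*_; _^_; _≤_; _<_; _≟_)
open import Data.Product using (Σ-syntax; ∃-syntax; _×_; _,_)
open import Data.Sum using (_⊎_)
open import Data.Vec using (Vec; tabulate; toList)
import Data.Vec.Relation.Unary.Any as Vec
open import Function.Bundles using (_⇔_)
open import Level using (0ℓ)
open import Relation.Binary using (Rel; Irreflexive; Symmetric)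
open import Relation.Binary.PropositionalEquality using (_≡_; _≢_)
open import Relation.Nullary using (¬_; does)

------------------------------------------------------------------------
-- Algorithms
--
-- The model of computation is Jones' WHILE language over binary trees
-- ("Computability and Complexity from a Programming Perspective").
-- Sharing subtrees makes every operation a constant number of pointer
-- operations, so the unit-cost time below is polynomially related to
-- Turing-machine time.

infixr 5 _∙_

data Tree : Set where
  nil : Tree
  _∙_ : Tree → Tree → Tree

head tail : Tree → Tree
head nil     = nil
head (l ∙ r) = l
tail nil     = nil
tail (l ∙ r) = r

Var : Set
Var = ℕ

data Expr : Set where
  var   : Var → Expr
  nil   : Expr
  cons  : Expr → Expr → Expr
  hd tl : Expr → Expr

infix  6 _≔_
infixr 5 _⨾_

data Command : Set where
  _≔_   : Var → Expr → Command
  _⨾_   : Command → Command → Command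
  cond  : Expr → Command → Command → Command
  while : Expr → Command → Command

Store : Set
Store = Var → Tree

_[_↦_] : Store → Var → Tree → Store
(σ [ x ↦ t ]) y = if does (y ≟ x) then t else σ y

eval : Expr → Store → Tree
eval (var x)    σ = σ x
eval nil        σ = nil
eval (cons d e) σ = eval d σ ∙ eval e σ
eval (hd e)     σ = head (eval e σ)
eval (tl e)     σ = tail (eval e σ)

cost : Expr → ℕ
cost (var x)    = 1
cost nil        = 1
cost (cons d e) = suc (cost d + cost e)
cost (hd e)     = suc (cost e)
cost (tl e)     = suc (cost e)

-- ⟨ C , σ ⟩⇓ σ′ [ t ]: started in store σ, the command C halts in store σ′
-- after t steps.  In tests, nil is false and every other tree is true.

infix 4 ⟨_,_⟩⇓_[_]

data ⟨_,_⟩⇓_[_] : Command → Store → Store → ℕ → Set where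
  assign : ∀ {x e σ} →
           ⟨ x ≔ e , σ ⟩⇓ σ [ x ↦ eval e σ ] [ suc (cost e) ]
  seq    : ∀ {C D σ σ′ σ″ t u} →
           ⟨ C , σ ⟩⇓ σ′ [ t ] → ⟨ D , σ′ ⟩⇓ σ″ [ u ] →
           ⟨ C ⨾ D , σ ⟩⇓ σ″ [ t + u ]
  cond-t : ∀ {e C D σ σ′ t} → eval e σ ≢ nil →
           ⟨ C , σ ⟩⇓ σ′ [ t ] →
           ⟨ cond e C D , σ ⟩⇓ σ′ [ suc (cost e) + t ]
  cond-f : ∀ {e C D σ σ′ t} → eval e σ ≡ nil →
           ⟨ D , σ ⟩⇓ σ′ [ t ] →
           ⟨ cond e C D , σ ⟩⇓ σ′ [ suc (cost e) + t ]
  loop   : ∀ {e C σ σ′ σ″ t u} → eval e σ ≢ nil →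
           ⟨ C , σ ⟩⇓ σ′ [ t ] → ⟨ while e C , σ′ ⟩⇓ σ″ [ u ] →
           ⟨ while e C , σ ⟩⇓ σ″ [ suc (cost e) + (t + u) ]
  exit   : ∀ {e C σ} → eval e σ ≡ nil →
           ⟨ while e C , σ ⟩⇓ σ [ suc (cost e) ]

-- A program reads its input from variable 0 and leaves its output there;
-- all other variables are initially nil.

initial : Tree → Store
initial t zero    = t
initial t (suc _) = nil

Computes_⟶_In_ : Command → Tree → Tree → ℕ → Set
Computes_⟶_In_ C i o t = ∃[ σ ] ⟨ C , initial i ⟩⇓ σ [ t ] × σ 0 ≡ o

------------------------------------------------------------------------
-- Decision problems and running time

record DecisionProblem : Set₁ where
  field
    Instance : Set
    Yes      : Instance → Set
    encode   : Instance → Tree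

-- C decides P, halting on each instance x after a number t of steps that
-- satisfies Bound x t.
Decides : (P : DecisionProblem) → Command →
          (DecisionProblem.Instance P → ℕ → Set) → Set
Decides P C Bound =
  ∀ x → ∃[ o ] ∃[ t ]
    (Computes C ⟶ encode x In o) t × Bound x t × (o ≢ nil ⇔ Yes x)
  where open DecisionProblem P

-- f(n) = o(n).  Taking f to be ℕ-valued loses nothing, as rounding up
-- preserves o(n).
Sublinear : (ℕ → ℕ) → Set
Sublinear f = ∀ c → ∃[ N ] ∀ n → N ≤ n → c * f n ≤ n

encodeBool : Bool → Tree
encodeBool false = nil
encodeBool true  = nil ∙ nil

encodeℕ : ℕ → Tree
encodeℕ zero    = nil
encodeℕ (suc n) = nil ∙ encodeℕ n

encodeList : {A : Set} → (A → Tree) → List A → Tree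
encodeList f []       = nil
encodeList f (x ∷ xs) = f x ∙ encodeList f xs

------------------------------------------------------------------------
-- 3-SAT and the Exponential Time Hypothesis

-- A variable together with the truth value that makes the literal true.
Literal : ℕ → Set
Literal n = Fin n × Bool

-- Literals may repeat within a clause, so shorter clauses are included.
Clause : ℕ → Set
Clause n = Vec (Literal n) 3

-- The clauses form a set: with unboundedly many repetitions a formula could
-- not even be read in time depending on the number of variables only.
record 3CNF : Set where
  field
    variables : ℕ
    clauses   : List (Clause variables)
    distinct  : Unique clauses

module _ {n : ℕ} (ρ : Fin n → Bool) where

  LiteralTrue : Literal n → Set
  LiteralTrue (x , b) = ρ x ≡ b

  ClauseTrue : Clause n → Set
  ClauseTrue = Vec.Any LiteralTrue

Satisfiable : 3CNF → Set
Satisfiable φ = Σ[ ρ ∈ (Fin variables → Bool) ] All (ClauseTrue ρ) clauses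
  where open 3CNF φ

encodeLiteral : ∀ {n} → Literal n → Tree
encodeLiteral (x , b) = encodeℕ (toℕ x) ∙ encodeBool b

encodeClause : ∀ {n} → Clause n → Tree
encodeClause c = encodeList encodeLiteral (toList c)

encode3CNF : 3CNF → Tree
encode3CNF φ = encodeℕ variables ∙ encodeList encodeClause clauses
  where open 3CNF φ

3SAT : DecisionProblem
3SAT = record { Instance = 3CNF ; Yes = Satisfiable ; encode = encode3CNF }

ETH : Set
ETH = ¬ (∃[ C ] ∃[ f ] Sublinear f ×
         Decides 3SAT C (λ φ t → t ≤ 2 ^ f (3CNF.variables φ)))

------------------------------------------------------------------------
-- Graphs

record Graph : Set where
  field
    order : ℕ

  V : Set
  V = Fin order

  field
    adjacent : V → V → Bool

  infix 4 _~_

  _~_ : Rel V 0ℓ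
  u ~ v = T (adjacent u v)

  field
    ~-sym    : Symmetric _~_
    ~-irrefl : Irreflexive _≡_ _~_

  N[_] : V → Subset order
  N[ v ] = tabulate λ u → does (u Fin.≟ v) ∨ adjacent v u

  Dominating : Subset order → Set
  Dominating S = ∀ v → v ∈ S ⊎ (∃[ u ] v ~ u × u ∈ S)

  M : V → Subset order → ℕ
  M u S = ∣ N[ u ] ∩ S ∣

  maxMembership : Subset order → ℕ
  maxMembership S = max 0 (map (λ u → M u S) (allFin order))

  VertexCover : Subset order → Set
  VertexCover S = ∀ {u v} → u ~ v → u ∈ S ⊎ v ∈ S

  MinimumVertexCoverSize : ℕ → Set
  MinimumVertexCoverSize s =
    (∃[ S ] VertexCover S × ∣ S ∣ ≡ s) ×
    (∀ S → VertexCover S → s ≤ ∣ S ∣)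

-- The adjacency matrix, row by row.
encodeGraph : Graph → Tree
encodeGraph G = encodeList row (allFin order)
  where
  open Graph G
  row : V → Tree
  row u = encodeList (λ v → encodeBool (adjacent u v)) (allFin order)

------------------------------------------------------------------------
-- Minimum Membership Dominating Set

record MMDSInstance : Set where
  field
    graph : Graph
    k     : ℕ
    k>0   : 0 < k

HasMMDS : MMDSInstance → Set
HasMMDS I = ∃[ S ] Dominating S × maxMembership S ≤ k
  where
  open MMDSInstance I
  open Graph graph

encodeMMDS : MMDSInstance → Tree
encodeMMDS I = encodeGraph graph ∙ encodeℕ k
  where open MMDSInstance I

MMDS : DecisionProblem
MMDS = record { Instance = MMDSInstance ; Yes = HasMMDS ; encode = encodeMMDS }

-- t ≤ 2^f(vc) · |V|^O(1).  The base is 1 + |V| because a bare |V|^c would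
-- demand running time 0 on the empty graph; for |V| ≥ 1 the two differ by a
-- factor of at most 2^c, which f absorbs.
VCTimeBound : (f : ℕ → ℕ) (c : ℕ) → MMDSInstance → ℕ → Set
VCTimeBound f c I t =
  ∀ vc → MinimumVertexCoverSize vc → t ≤ 2 ^ f vc * suc order ^ c
  where
  open MMDSInstance I
  open Graph graph

-- A 3-CNF formula over n variables, to which one dummy variable is added, is
-- turned into a graph with a clique on its 2(n + 1) literals, and with n + 2
-- copies of a vertex for each clause, joined to the literals of the clause; the
-- tautologies x ∨ ¬ x count as clauses, too.  The literals cover all edges, so
-- that vc ≤ 2(n + 1) whatever the number of clauses.  Put k = n + 1.  The true
-- literals of a satisfying assignment form a dominating set with just k
-- elements.  Conversely, let S be dominating with membership at most k.  If S
-- missed all literals of a clause, it would contain the k + 1 copies of the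
-- clause, all adjacent to a single literal.  Hence S hits every clause; by the
-- tautologies it contains a literal of each variable, and by the clique at most
-- k literals altogether, so it is a satisfying assignment.
--
-- As f need not be monotone, its maximum over all vc ≤ 2(n + 1) enters the time
-- bound for 3-SAT; polynomial factors are absorbed by a logarithm in the exponent.

module Submission where

open import Defs
open import Data.Bool using (Bool; true; false; not; T; if_then_else_; _∧_; _∨_)
import Data.Bool.Properties as Bool
open import Data.Empty using (⊥; ⊥-elim)
open import Data.Fin using (Fin; zero; suc; toℕ; fromℕ<; combine)
import Data.Fin.Properties as Fin
open import Data.Fin.Subset using (Subset; _∈_; _∩_; ∣_∣; inside; outside)
open import Data.Fin.Subset.Properties using (x∈p∩q⁺; ∣p∩q∣≤∣q∣)
open import Data.List using (List; []; _∷_; _++_; map; concatMap; downFrom; length; allFin)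
import Data.List as List
open import Data.List.Extrema.Nat using (xs≤max; max≤v⁺)
open import Data.List.Membership.Propositional using () renaming (_∈_ to _∈ˡ_)
open import Data.List.Membership.Propositional.Properties
open import Data.List.Properties using (++-assoc; tabulate-lookup; length-downFrom)
open import Data.List.Relation.Unary.All using (All)
import Data.List.Relation.Unary.All as All
import Data.List.Relation.Unary.All.Properties as All
open import Data.List.Relation.Unary.Any using (here; there; index; satisfied)
import Data.List.Relation.Unary.Any as Any
open import Data.List.Relation.Unary.Any.Properties using (lookup-index)
open import Data.List.Relation.Unary.AllPairs using ([]; _∷_)
open import Data.List.Relation.Unary.Unique.Propositional using (Unique)
open import Data.Nat using (ℕ; zero; suc; pred; _+_; _*_; _^_; _∸_; _≤_; _<_; _⊔_; _≟_; _≤?_; _<?_; z≤n; s≤s)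
open import Data.Nat.Properties hiding (_≟_; _≤?_; _<?_)
open import Data.Nat.Solver using (module +-*-Solver)
open import Data.Product using (Σ-syntax; ∃-syntax; _×_; _,_; proj₁; proj₂)
open import Data.Sum using (_⊎_; inj₁; inj₂)
open import Data.Vec using (Vec; []; _∷_; lookup; tabulate; toList)
open import Data.Vec.Membership.Propositional using (find) renaming (_∈_ to _∈ᵛ_)
open import Data.Vec.Properties using (lookup⇒[]=; lookup∘tabulate)
import Data.Vec as Vec
import Data.Vec.Properties as Vec
import Data.Vec.Relation.Unary.Any as VecAny
import Data.Vec.Relation.Unary.Any.Properties as VecAny
open import Function using (_∘_)
open import Function.Bundles using (mk⇔; Equivalence)
open import Relation.Binary using (DecidableEquality; tri<; tri≈; tri>)
open import Relation.Binary.PropositionalEquality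
open import Relation.Nullary using (¬_; Dec; yes; no; does; map′; _×-dec_)
open import Relation.Nullary.Decidable using (dec-true; dec-false; decidable-stable; does-⇔)

-- Stores up to pointwise equality

infix 4 _≈_

_≈_ : Store → Store → Set
σ ≈ σ′ = ∀ x → σ x ≡ σ′ x

update-cong : ∀ {σ σ′ t t′} x → σ ≈ σ′ → t ≡ t′ → (σ [ x ↦ t ]) ≈ (σ′ [ x ↦ t′ ])
-- `does (y ≟ x)` computes to this Boolean, so one abstraction unlocks both updates.
update-cong x σ≈ t≡ y with y Data.Nat.≡ᵇ x
... | true  = t≡
... | false = σ≈ y

eval-cong : ∀ e {σ σ′} → σ ≈ σ′ → eval e σ ≡ eval e σ′
eval-cong (var x)    σ≈ = σ≈ x
eval-cong nil        σ≈ = refl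
eval-cong (cons d e) σ≈ = cong₂ _∙_ (eval-cong d σ≈) (eval-cong e σ≈)
eval-cong (hd e)     σ≈ = cong head (eval-cong e σ≈)
eval-cong (tl e)     σ≈ = cong tail (eval-cong e σ≈)

-- Expressions see only the values in a store, so the same rules apply at the same cost. This stands
-- in for function extensionality when a program is started in a store that merely agrees with
-- `initial y`.
exec-cong : ∀ {C σ τ σ′ t} → ⟨ C , σ ⟩⇓ σ′ [ t ] → σ ≈ τ →
            ∃[ τ′ ] ⟨ C , τ ⟩⇓ τ′ [ t ] × σ′ ≈ τ′
exec-cong (assign {x} {e}) σ≈ = _ , assign , update-cong x σ≈ (eval-cong e σ≈)
exec-cong (seq p q) σ≈ with exec-cong p σ≈
... | _ , p′ , σ′≈ with exec-cong q σ′≈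
... | _ , q′ , σ″≈ = _ , seq p′ q′ , σ″≈
exec-cong (cond-t {e} ne p) σ≈ with exec-cong p σ≈
... | _ , p′ , σ′≈ = _ , cond-t (λ eq → ne (trans (eval-cong e σ≈) eq)) p′ , σ′≈
exec-cong (cond-f {e} eq p) σ≈ with exec-cong p σ≈
... | _ , p′ , σ′≈ = _ , cond-f (trans (sym (eval-cong e σ≈)) eq) p′ , σ′≈
exec-cong (loop {e} ne p q) σ≈ with exec-cong p σ≈
... | _ , p′ , σ′≈ with exec-cong q σ′≈
... | _ , q′ , σ″≈ = _ , loop (λ eq → ne (trans (eval-cong e σ≈) eq)) p′ q′ , σ″≈
exec-cong (exit {e} eq) σ≈ = _ , exit (trans (sym (eval-cong e σ≈)) eq) , σ≈

-- A first-order functional language, compiled to WHILE.  `fold xs s body`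
-- recurses on the right spine of xs; the body sees the current suffix of xs
-- (not merely its head) as variable 0 and the accumulator as variable 1.

data Term (n : ℕ) : Set where
  var         : Fin n → Term n
  nil         : Term n
  cons        : Term n → Term n → Term n
  hd tl       : Term n → Term n
  cond        : Term n → Term n → Term n → Term n
  bind        : Term n → Term (suc n) → Term n
  fold        : Term n → Term n → Term (suc (suc n)) → Term n

choose : Tree → Tree → Tree → Tree
choose nil     a b = b
choose (_ ∙ _) a b = a

foldSpine : (Tree → Tree → Tree) → Tree → Tree → Tree
foldSpine f s nil      = s
foldSpine f s (x ∙ xs) = f (x ∙ xs) (foldSpine f s xs)

⟦_⟧ : ∀ {n} → Term n → Vec Tree n → Tree
⟦ var i ⟧                ρ = lookup ρ i
⟦ nil ⟧                  ρ = nil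
⟦ cons a b ⟧             ρ = ⟦ a ⟧ ρ ∙ ⟦ b ⟧ ρ
⟦ hd a ⟧                 ρ = head (⟦ a ⟧ ρ)
⟦ tl a ⟧                 ρ = tail (⟦ a ⟧ ρ)
⟦ cond c a b ⟧   ρ = choose (⟦ c ⟧ ρ) (⟦ a ⟧ ρ) (⟦ b ⟧ ρ)
⟦ bind a b ⟧             ρ = ⟦ b ⟧ (⟦ a ⟧ ρ ∷ ρ)
⟦ fold xs s b ⟧          ρ = foldSpine (λ x acc → ⟦ b ⟧ (x ∷ acc ∷ ρ)) (⟦ s ⟧ ρ) (⟦ xs ⟧ ρ)

-- Variable 0 holds the result, variable 1 the environment and variable 2 a
-- stack of intermediate values.

path : ∀ {n} → Fin n → Expr → Expr
path zero    e = e
path (suc i) e = path i (tl e)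

-- The top of the stack is a list being built. It ends up with the shortest suffix in front, which
-- is the one that `foldSpine` processes first.
pushSuffixes : Command
pushSuffixes = while (var 0) (2 ≔ cons (cons (var 0) (hd (var 2))) (tl (var 2)) ⨾ 0 ≔ tl (var 0))

enterBody leaveBody : Command
enterBody = 1 ≔ cons (hd (hd (var 2))) (cons (var 0) (var 1)) ⨾ 2 ≔ cons (tl (hd (var 2))) (tl (var 2))
leaveBody = 1 ≔ tl (tl (var 1))

compile : ∀ {n} → Term n → Command
compile (var i)              = 0 ≔ hd (path i (var 1))
compile nil                  = 0 ≔ nil
compile (cons a b)           = compile a ⨾ 2 ≔ cons (var 0) (var 2) ⨾ compile b ⨾
                               0 ≔ cons (hd (var 2)) (var 0) ⨾ 2 ≔ tl (var 2)
compile (hd a)               = compile a ⨾ 0 ≔ hd (var 0)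
compile (tl a)               = compile a ⨾ 0 ≔ tl (var 0)
compile (cond c a b) = compile c ⨾ cond (var 0) (compile a) (compile b)
compile (bind a b)           = compile a ⨾ 1 ≔ cons (var 0) (var 1) ⨾ compile b ⨾ 1 ≔ tl (var 1)
compile (fold xs s b)        = compile xs ⨾ 2 ≔ cons nil (var 2) ⨾ pushSuffixes ⨾ compile s ⨾
                               while (hd (var 2)) (enterBody ⨾ compile b ⨾ leaveBody) ⨾
                               2 ≔ tl (var 2)

-- Running time of compiled terms

spine : Tree → ℕ
spine nil      = 0
spine (_ ∙ xs) = suc (spine xs)

-- In each iteration, 3 pays for the loop test, 15 for `enterBody` and 4 for `leaveBody`.
foldTime : (Tree → Tree → Tree) → (Tree → Tree → ℕ) → Tree → Tree → ℕ
foldTime f t s nil      = 0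
foldTime f t s (x ∙ xs) = foldTime f t s xs + (3 + (15 + (t (x ∙ xs) (foldSpine f s xs) + 4)))

time : ∀ {n} → Term n → Vec Tree n → ℕ
time (var i)              ρ = suc (suc (cost (path i (var 1))))
time nil                  ρ = 2
time (cons a b)           ρ = time a ρ + (4 + (time b ρ + 8))
time (hd a)               ρ = time a ρ + 3
time (tl a)               ρ = time a ρ + 3
-- Only one branch runs; charging for both keeps the bound independent of the outcome of the test.
time (cond c a b) ρ = time c ρ + (2 + (time a ρ + time b ρ))
time (bind a b)           ρ = time a ρ + (4 + (time b (⟦ a ⟧ ρ ∷ ρ) + 3))
-- Each pass of `pushSuffixes` takes 13 steps and its last test 2; the final 3 + 3 are the failing
-- loop test and the removal of the empty list from the stack.
time (fold xs s b)        ρ =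
  time xs ρ + (4 + (spine (⟦ xs ⟧ ρ) * 13 + 2 + (time s ρ +
  (foldTime (λ x acc → ⟦ b ⟧ (x ∷ acc ∷ ρ)) (λ x acc → time b (x ∷ acc ∷ ρ))
            (⟦ s ⟧ ρ) (⟦ xs ⟧ ρ) + 3 + 3))))

environment : ∀ {n} → Vec Tree n → Tree
environment []      = nil
environment (x ∷ ρ) = x ∙ environment ρ

-- Timed runs of compiled code

record State : Set where
  constructor state
  field
    result env stack : Tree

store : State → Store
store (state r e k) 0 = r
store (state r e k) 1 = e
store (state r e k) 2 = k
store (state r e k) (suc (suc (suc _))) = nil

-- Every store agreeing with the initial state is allowed, so that runs chain without function
-- extensionality. The time is only bounded, because `time` overcharges conditionals.
Runs : Command → State → State → ℕ → Set
Runs C s s′ b = ∀ {σ} → σ ≈ store s →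
  ∃[ σ′ ] ∃[ t ] ⟨ C , σ ⟩⇓ σ′ [ t ] × σ′ ≈ store s′ × t ≤ b

infixr 5 _then_

_then_ : ∀ {C D s s′ s″ t u} → Runs C s s′ t → Runs D s′ s″ u → Runs (C ⨾ D) s s″ (t + u)
(p then q) σ≈ with p σ≈
... | _ , _ , p′ , σ′≈ , t≤ with q σ′≈
... | _ , _ , q′ , σ″≈ , u≤ = _ , _ , seq p′ q′ , σ″≈ , +-mono-≤ t≤ u≤

set₀ : ∀ e {s} → Runs (0 ≔ e) s (record s { result = eval e (store s) }) (suc (cost e))
set₀ e {s} σ≈ = _ , _ , assign , agree , ≤-refl
  where
  agree : _ ≈ _
  agree zero                = eval-cong e σ≈
  agree (suc zero)          = σ≈ 1
  agree (suc (suc zero))    = σ≈ 2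
  agree (suc (suc (suc x))) = σ≈ (suc (suc (suc x)))

set₁ : ∀ e {s} → Runs (1 ≔ e) s (record s { env = eval e (store s) }) (suc (cost e))
set₁ e {s} σ≈ = _ , _ , assign , agree , ≤-refl
  where
  agree : _ ≈ _
  agree zero                = σ≈ 0
  agree (suc zero)          = eval-cong e σ≈
  agree (suc (suc zero))    = σ≈ 2
  agree (suc (suc (suc x))) = σ≈ (suc (suc (suc x)))

set₂ : ∀ e {s} → Runs (2 ≔ e) s (record s { stack = eval e (store s) }) (suc (cost e))
set₂ e {s} σ≈ = _ , _ , assign , agree , ≤-refl
  where
  agree : _ ≈ _
  agree zero                = σ≈ 0
  agree (suc zero)          = σ≈ 1
  agree (suc (suc zero))    = eval-cong e σ≈
  agree (suc (suc (suc x))) = σ≈ (suc (suc (suc x)))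

weaken : ∀ {C s s′ t u} → t ≤ u → Runs C s s′ t → Runs C s s′ u
weaken t≤u p σ≈ with p σ≈
... | _ , _ , p′ , σ′≈ , le = _ , _ , p′ , σ′≈ , ≤-trans le t≤u

branch-true : ∀ e {C D s s′ t} → eval e (store s) ≢ nil → Runs C s s′ t →
              Runs (cond e C D) s s′ (suc (cost e) + t)
branch-true e ne p σ≈ with p σ≈
... | _ , _ , p′ , σ′≈ , t≤ =
  _ , _ , cond-t (λ eq → ne (trans (sym (eval-cong e σ≈)) eq)) p′ , σ′≈ , +-monoʳ-≤ (suc (cost e)) t≤

branch-false : ∀ e {C D s s′ t} → eval e (store s) ≡ nil → Runs D s s′ t →
               Runs (cond e C D) s s′ (suc (cost e) + t)
branch-false e eq p σ≈ with p σ≈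
... | _ , _ , p′ , σ′≈ , t≤ =
  _ , _ , cond-f (trans (eval-cong e σ≈) eq) p′ , σ′≈ , +-monoʳ-≤ (suc (cost e)) t≤

while-true : ∀ e {C s s′ s″ t u} → eval e (store s) ≢ nil → Runs C s s′ t → Runs (while e C) s′ s″ u →
             Runs (while e C) s s″ (suc (cost e) + (t + u))
while-true e ne p q σ≈ with p σ≈
... | _ , _ , p′ , σ′≈ , t≤ with q σ′≈
... | _ , _ , q′ , σ″≈ , u≤ =
  _ , _ , loop (λ eq → ne (trans (sym (eval-cong e σ≈)) eq)) p′ q′ , σ″≈ ,
  +-monoʳ-≤ (suc (cost e)) (+-mono-≤ t≤ u≤)

while-false : ∀ e {C s} → eval e (store s) ≡ nil → Runs (while e C) s s (suc (cost e))
while-false e eq σ≈ = _ , _ , exit (trans (eval-cong e σ≈) eq) , σ≈ , ≤-refl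

∙≢nil : ∀ {x y} → x ∙ y ≢ nil
∙≢nil ()

suffixes : Tree → Tree → Tree
suffixes nil      ys = ys
suffixes (x ∙ xs) ys = suffixes xs ((x ∙ xs) ∙ ys)

pushSuffixes-runs : ∀ xs {ys e k} →
  Runs pushSuffixes (state xs e (ys ∙ k)) (state nil e (suffixes xs ys ∙ k)) (spine xs * 13 + 2)
pushSuffixes-runs nil      = while-false (var 0) refl
pushSuffixes-runs (x ∙ xs) =
  while-true (var 0) ∙≢nil
    (set₂ (cons (cons (var 0) (hd (var 2))) (tl (var 2))) then set₀ (tl (var 0)))
    (pushSuffixes-runs xs)

-- The induction meets the suffixes in the order of pushing, the loop in the opposite order. Hence
-- the run of the loop on what lies below them is a premise, and each induction step prepends one
-- iteration to it.
fold-runs : ∀ {n} {ρ : Vec Tree n} {C f t} →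
  (∀ x acc {r k} → Runs C (state r (x ∙ acc ∙ environment ρ) k)
                          (state (f x acc) (x ∙ acc ∙ environment ρ) k) (t x acc)) →
  ∀ s xs {ys k s′ u} →
  let e = environment ρ ; L = while (hd (var 2)) (enterBody ⨾ C ⨾ leaveBody) in
  Runs L (state (foldSpine f s xs) e (ys ∙ k)) s′ u →
  Runs L (state s e (suffixes xs ys ∙ k)) s′ (foldTime f t s xs + u)
fold-runs body s nil rest = rest
fold-runs {ρ = ρ} {C} {f} {t} body s (x ∙ xs) {u = u} rest =
  weaken (≤-reflexive (sym (+-assoc (foldTime f t s xs) _ u)))
    (fold-runs {ρ = ρ} {t = t} body s xs
      (while-true (hd (var 2)) ∙≢nil
        ((set₁ (cons (hd (hd (var 2))) (cons (var 0) (var 1))) then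
          set₂ (cons (tl (hd (var 2))) (tl (var 2)))) then
         body (x ∙ xs) (foldSpine f s xs) then
         set₁ (tl (tl (var 1))))
        rest))

path-eval : ∀ {n} (i : Fin n) (ρ : Vec Tree n) e σ → eval e σ ≡ environment ρ →
            eval (hd (path i e)) σ ≡ lookup ρ i
path-eval zero    (x ∷ ρ) e σ eq = cong head eq
path-eval (suc i) (x ∷ ρ) e σ eq = path-eval i ρ (tl e) σ (cong tail eq)

Runs-resp-≡ : ∀ {C s s₁ s₂ t} → s₁ ≡ s₂ → Runs C s s₁ t → Runs C s s₂ t
Runs-resp-≡ refl p = p

-- The statement covers every stack and leaves it as found; this is why values saved by an enclosing
-- term survive the evaluation of its subterms.
compile-runs : ∀ {n} (a : Term n) (ρ : Vec Tree n) {r k} →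
  Runs (compile a) (state r (environment ρ) k) (state (⟦ a ⟧ ρ) (environment ρ) k) (time a ρ)
compile-runs (var i) ρ {r} {k} =
  Runs-resp-≡ (cong (λ v → state v (environment ρ) k) (path-eval i ρ (var 1) (store (state r (environment ρ) k)) refl))
       (set₀ (hd (path i (var 1))))
compile-runs nil ρ = set₀ nil
compile-runs (cons a b) ρ =
  compile-runs a ρ then set₂ (cons (var 0) (var 2)) then compile-runs b ρ then
  set₀ (cons (hd (var 2)) (var 0)) then set₂ (tl (var 2))
compile-runs (hd a) ρ = compile-runs a ρ then set₀ (hd (var 0))
compile-runs (tl a) ρ = compile-runs a ρ then set₀ (tl (var 0))
compile-runs (cond c a b) ρ {r} {k} = compile-runs c ρ then branch (⟦ c ⟧ ρ)
  where
  branch : ∀ x → Runs (cond (var 0) (compile a) (compile b)) (state x (environment ρ) k)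
                      (state (choose x (⟦ a ⟧ ρ) (⟦ b ⟧ ρ)) (environment ρ) k)
                      (2 + (time a ρ + time b ρ))
  branch nil     = weaken (+-monoʳ-≤ 2 (m≤n+m _ _)) (branch-false (var 0) refl (compile-runs b ρ))
  branch (_ ∙ _) = weaken (+-monoʳ-≤ 2 (m≤m+n _ _)) (branch-true (var 0) ∙≢nil (compile-runs a ρ))
compile-runs (bind a b) ρ =
  compile-runs a ρ then set₁ (cons (var 0) (var 1)) then
  compile-runs b (⟦ a ⟧ ρ ∷ ρ) then set₁ (tl (var 1))
compile-runs (fold xs s b) ρ =
  compile-runs xs ρ then set₂ (cons nil (var 2)) then pushSuffixes-runs (⟦ xs ⟧ ρ) then
  compile-runs s ρ then
  fold-runs {ρ = ρ} {t = λ x acc → time b (x ∷ acc ∷ ρ)} (λ x acc → compile-runs b (x ∷ acc ∷ ρ)) (⟦ s ⟧ ρ) (⟦ xs ⟧ ρ)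
    (while-false (hd (var 2)) refl) then
  set₂ (tl (var 2))

-- Variable 1 is reset because the command run next may rely on every variable
-- but 0 being nil.

program : Term 1 → Command
program a = 1 ≔ cons (var 0) nil ⨾ compile a ⨾ 1 ≔ nil

program-runs : ∀ a x {σ} → σ ≈ initial x →
  ∃[ σ′ ] ∃[ t ] ⟨ program a , σ ⟩⇓ σ′ [ t ] × σ′ ≈ initial (⟦ a ⟧ (x ∷ [])) × t ≤ 4 + (time a (x ∷ []) + 2)
program-runs a x σ≈ with (set₁ (cons (var 0) nil) then compile-runs a (x ∷ []) then set₁ nil)
                           {σ = _} (λ y → trans (σ≈ y) (agree y))
  where
  agree : initial x ≈ store (state x nil nil)
  agree zero                = refl
  agree (suc zero)          = refl
  agree (suc (suc zero))    = refl
  agree (suc (suc (suc _))) = refl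
... | σ′ , t , p , σ′≈ , t≤ = σ′ , t , p , (λ y → trans (σ′≈ y) (agree y)) , t≤
  where
  agree : ∀ {z} → store (state z nil nil) ≈ initial z
  agree zero                = refl
  agree (suc zero)          = refl
  agree (suc (suc zero))    = refl
  agree (suc (suc (suc _))) = refl

compose : ∀ a {C x y o t} → ⟦ a ⟧ (x ∷ []) ≡ y → (Computes C ⟶ y In o) t →
  ∃[ u ] (Computes program a ⨾ C ⟶ x In o) (u + t) × u ≤ 4 + (time a (x ∷ []) + 2)
compose a refl (σ , p , out) with program-runs a _ (λ _ → refl)
... | σ₁ , u , q , σ₁≈ , u≤ with exec-cong p (λ y → sym (σ₁≈ y))
... | σ₂ , p′ , σ≈ = u , (σ₂ , seq q p′ , trans (sym (σ≈ 0)) out) , u≤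

-- Size and time bounds

size : Tree → ℕ
size nil     = 0
size (l ∙ r) = suc (size l + size r)

spine≤size : ∀ t → spine t ≤ size t
spine≤size nil     = z≤n
spine≤size (l ∙ r) = s≤s (≤-trans (spine≤size r) (m≤n+m _ _))

head-size : ∀ t → size (head t) ≤ size t
head-size nil     = z≤n
head-size (l ∙ r) = m≤n⇒m≤1+n (m≤m+n _ _)

tail-size : ∀ t → size (tail t) ≤ size t
tail-size nil     = z≤n
tail-size (l ∙ r) = m≤n⇒m≤1+n (m≤n+m _ _)

choose-size : ∀ t a b → size (choose t a b) ≤ size a + size b
choose-size nil     a b = m≤n+m _ _
choose-size (_ ∙ _) a b = m≤m+n _ _

infixl 6 _⊕_
infixl 7 _⊗_

-- Syntax rather than functions, so that the shape of a computed bound can be compared by `refl`.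
data Poly : Set where
  con     : ℕ → Poly
  X       : Poly
  _⊕_ _⊗_ : Poly → Poly → Poly

_at_ : Poly → ℕ → ℕ
con c   at s = c
X       at s = s
(p ⊕ q) at s = p at s + q at s
(p ⊗ q) at s = p at s * q at s

pow-+ˡ : ∀ s a b → (2 + s) ^ a ≤ (2 + s) ^ (a + b)
pow-+ˡ s a b = ^-monoʳ-≤ (2 + s) (m≤m+n a b)

pow-+ʳ : ∀ s a b → (2 + s) ^ b ≤ (2 + s) ^ (a + b)
pow-+ʳ s a b = ^-monoʳ-≤ (2 + s) (m≤n+m b a)

-- The base is at least 2, so one more factor pays for adding two powers. For this reason all
-- polynomial bounds use the base `2 + s`.
pow-sum : ∀ s a b → (2 + s) ^ a + (2 + s) ^ b ≤ (2 + s) ^ suc (a + b)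
pow-sum s a b = begin
  (2 + s) ^ a + (2 + s) ^ b             ≤⟨ +-mono-≤ (pow-+ˡ s a b) (pow-+ʳ s a b) ⟩
  (2 + s) ^ (a + b) + (2 + s) ^ (a + b) ≡⟨ cong ((2 + s) ^ (a + b) +_) (+-identityʳ _) ⟨
  2 * (2 + s) ^ (a + b)                 ≤⟨ *-monoˡ-≤ ((2 + s) ^ (a + b)) (m≤m+n 2 s) ⟩
  (2 + s) * (2 + s) ^ (a + b)           ∎
  where open ≤-Reasoning

n≤2^n : ∀ n → n ≤ 2 ^ n
n≤2^n zero    = z≤n
n≤2^n (suc n) = begin
  1 + n           ≤⟨ +-mono-≤ (m^n>0 2 n) (n≤2^n n) ⟩
  2 ^ n + 2 ^ n   ≡⟨ cong (2 ^ n +_) (+-identityʳ _) ⟨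
  2 * 2 ^ n       ∎
  where open ≤-Reasoning

-- Opaque: the concrete degrees are large, and unfolding powers to them is
-- prohibitively expensive.

opaque

  degree-bound : ∀ p → ∃[ d ] ∀ s → p at s ≤ (2 + s) ^ d
  degree-bound (con c) = c , λ s → ≤-trans (n≤2^n c) (^-monoˡ-≤ c (m≤m+n 2 s))
  degree-bound X       = 1 , λ s → ≤-trans (m≤n+m s 2) (≤-reflexive (sym (*-identityʳ _)))
  degree-bound (p ⊕ q) with degree-bound p | degree-bound q
  ... | a , p≤ | b , q≤ = suc (a + b) , λ s → ≤-trans (+-mono-≤ (p≤ s) (q≤ s)) (pow-sum s a b)
  degree-bound (p ⊗ q) with degree-bound p | degree-bound q
  ... | a , p≤ | b , q≤ = a + b , λ s →
    ≤-trans (*-mono-≤ (p≤ s) (q≤ s)) (≤-reflexive (sym (^-distribˡ-+-* (2 + s) a b)))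

-- All bounds are polynomials in one parameter `s`, in the end the size of the input. Sizes are
-- tracked along with times because a fold takes time proportional to the length of its list.
record Bounded {n} (Γ : Vec Poly n) (a : Term n) : Set where
  constructor bounded
  field
    sizeBound timeBound : Poly
    holds : ∀ s ρ → (∀ i → size (lookup ρ i) ≤ lookup Γ i at s) →
            size (⟦ a ⟧ ρ) ≤ sizeBound at s × time a ρ ≤ timeBound at s
open Bounded public

within : ∀ {n} {Γ : Vec Poly n} {p x ρ s} → size x ≤ p at s →
         (∀ i → size (lookup ρ i) ≤ lookup Γ i at s) →
         ∀ i → size (lookup (x ∷ ρ) i) ≤ lookup (p ∷ Γ) i at s
within x≤ ρ≤ zero    = x≤
within x≤ ρ≤ (suc i) = ρ≤ i

module _ {n} {Γ : Vec Poly n} where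

  varᵇ : ∀ i → Bounded Γ (var i)
  varᵇ i = bounded (lookup Γ i) (con (suc (suc (cost (path i (var 1)))))) λ s ρ ρ≤ → ρ≤ i , ≤-refl

  nilᵇ : Bounded Γ nil
  nilᵇ = bounded (con 0) (con 2) λ s ρ ρ≤ → z≤n , ≤-refl

  consᵇ : ∀ {a b} → Bounded Γ a → Bounded Γ b → Bounded Γ (cons a b)
  consᵇ A B = bounded
    (con 1 ⊕ sizeBound A ⊕ sizeBound B) (timeBound A ⊕ (con 4 ⊕ (timeBound B ⊕ con 8)))
    λ s ρ ρ≤ → let a₁ , a₂ = holds A s ρ ρ≤ ; b₁ , b₂ = holds B s ρ ρ≤ in
      s≤s (+-mono-≤ a₁ b₁) , +-mono-≤ a₂ (+-monoʳ-≤ 4 (+-monoˡ-≤ 8 b₂))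

  hdᵇ : ∀ {a} → Bounded Γ a → Bounded Γ (hd a)
  hdᵇ A = bounded (sizeBound A) (timeBound A ⊕ con 3)
    λ s ρ ρ≤ → let a₁ , a₂ = holds A s ρ ρ≤ in ≤-trans (head-size _) a₁ , +-monoˡ-≤ 3 a₂

  tlᵇ : ∀ {a} → Bounded Γ a → Bounded Γ (tl a)
  tlᵇ A = bounded (sizeBound A) (timeBound A ⊕ con 3)
    λ s ρ ρ≤ → let a₁ , a₂ = holds A s ρ ρ≤ in ≤-trans (tail-size _) a₁ , +-monoˡ-≤ 3 a₂

  ifᵇ : ∀ {c a b} → Bounded Γ c → Bounded Γ a → Bounded Γ b → Bounded Γ (cond c a b)
  ifᵇ {c} C A B = bounded (sizeBound A ⊕ sizeBound B) (timeBound C ⊕ (con 2 ⊕ (timeBound A ⊕ timeBound B)))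
    λ s ρ ρ≤ → let c₁ , c₂ = holds C s ρ ρ≤ ; a₁ , a₂ = holds A s ρ ρ≤ ; b₁ , b₂ = holds B s ρ ρ≤ in
      ≤-trans (choose-size (⟦ c ⟧ ρ) _ _) (+-mono-≤ a₁ b₁) , +-mono-≤ c₂ (+-monoʳ-≤ 2 (+-mono-≤ a₂ b₂))

  bindᵇ : ∀ {a b} (A : Bounded Γ a) → Bounded (sizeBound A ∷ Γ) b → Bounded Γ (bind a b)
  bindᵇ A B = bounded (sizeBound B) (timeBound A ⊕ (con 4 ⊕ (timeBound B ⊕ con 3)))
    λ s ρ ρ≤ → let a₁ , a₂ = holds A s ρ ρ≤ ; b₁ , b₂ = holds B s _ (within {p = sizeBound A} a₁ ρ≤) in
      b₁ , +-mono-≤ a₂ (+-monoʳ-≤ 4 (+-monoˡ-≤ 3 b₂))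

  -- The body may enlarge the accumulator by at most the fixed amount g, so
  -- that sizes grow linearly in the number of iterations.
  foldᵇ : ∀ {xs a b} (XS : Bounded Γ xs) (A : Bounded Γ a) g
          (B : ∀ p → Bounded (sizeBound XS ∷ p ∷ Γ) b) →
          (∀ s p → sizeBound (B p) at s ≤ g at s + p at s) →
          Bounded Γ (fold xs a b)
  foldᵇ {xs} {a} {b} XS A g B grows = bounded total
    (timeBound XS ⊕ (con 4 ⊕ (sizeBound XS ⊗ con 13 ⊕ con 2 ⊕ (timeBound A ⊕
      (sizeBound XS ⊗ step ⊕ con 3 ⊕ con 3)))))
    λ s ρ ρ≤ → let x₁ , x₂ = holds XS s ρ ρ≤ ; a₁ , a₂ = holds A s ρ ρ≤
                   n≤ = ≤-trans (spine≤size (⟦ xs ⟧ ρ)) x₁ in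
      ≤-trans (accumulated s ρ ρ≤ (⟦ xs ⟧ ρ) x₁ (⟦ a ⟧ ρ))
        (+-mono-≤ (*-monoˡ-≤ (g at s) n≤) a₁) ,
      +-mono-≤ x₂ (+-monoʳ-≤ 4 (+-mono-≤ (+-monoˡ-≤ 2 (*-monoˡ-≤ 13 n≤)) (+-mono-≤ a₂
        (+-monoˡ-≤ 3 (+-monoˡ-≤ 3 (≤-trans (spent s ρ ρ≤ (⟦ xs ⟧ ρ) x₁ (⟦ a ⟧ ρ) a₁)
          (*-monoˡ-≤ (step at s) n≤)))))))
    where
    total step : Poly
    total = sizeBound XS ⊗ g ⊕ sizeBound A
    step  = con 3 ⊕ (con 15 ⊕ (timeBound (B total) ⊕ con 4))

    module _ s (ρ : Vec Tree n) (ρ≤ : ∀ i → size (lookup ρ i) ≤ lookup Γ i at s) where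

      f : Tree → Tree → Tree
      f x acc = ⟦ b ⟧ (x ∷ acc ∷ ρ)

      accumulated : ∀ x → size x ≤ sizeBound XS at s → ∀ y →
                    size (foldSpine f y x) ≤ spine x * g at s + size y
      accumulated nil      x≤ y = ≤-refl
      accumulated (l ∙ x) x≤ y = begin
        size (f (l ∙ x) (foldSpine f y x))      ≤⟨ proj₁ (holds (B p) s _ (within {p = sizeBound XS} x≤
                                                     (within {p = p} ≤-refl ρ≤))) ⟩
        sizeBound (B p) at s                    ≤⟨ grows s p ⟩
        g at s + size (foldSpine f y x)         ≤⟨ +-monoʳ-≤ (g at s)
                                                     (accumulated x (≤-trans (tail-size (l ∙ x)) x≤) y) ⟩
        g at s + (spine x * g at s + size y)    ≡⟨ +-assoc (g at s) _ _ ⟨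
        spine (l ∙ x) * g at s + size y         ∎
        where
        open ≤-Reasoning
        p : Poly
        -- A constant polynomial: the accumulator is bounded by its own size, so that `grows`
        -- measures exactly one step.
        p = con (size (foldSpine f y x))

      spent : ∀ x → size x ≤ sizeBound XS at s → ∀ y → size y ≤ sizeBound A at s →
              foldTime f (λ x acc → time b (x ∷ acc ∷ ρ)) y x ≤ spine x * step at s
      spent nil      x≤ y y≤ = z≤n
      -- For the time, one bound must serve all iterations; `total` dominates every intermediate
      -- accumulator.
      spent (l ∙ x) x≤ y y≤ = ≤-trans
        (+-mono-≤ (spent x x≤′ y y≤)
          (+-monoʳ-≤ 3 (+-monoʳ-≤ 15 (+-monoˡ-≤ 4 (proj₂ (holds (B total) s _
            (within {p = sizeBound XS} x≤ (within {p = total} acc≤ ρ≤))))))))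
        (≤-reflexive (+-comm (spine x * step at s) (step at s)))
        where
        x≤′ = ≤-trans (tail-size (l ∙ x)) x≤
        acc≤ : size (foldSpine f y x) ≤ total at s
        acc≤ = ≤-trans (accumulated x x≤′ y)
          (+-mono-≤ (*-monoˡ-≤ (g at s) (≤-trans (spine≤size x) x≤′)) y≤)

module _ {n} {Γ : Vec Poly n} where

  -- The size bound of a `cons` or a `fold` has that of its tail or starting value as the outermost
  -- summand. If this is the accumulator, `refl` proves the growth condition.
  linearFoldᵇ : ∀ {xs a b g} (XS : Bounded Γ xs) (A : Bounded Γ a)
                (B : ∀ p → Bounded (sizeBound XS ∷ p ∷ Γ) b) →
                (∀ p → sizeBound (B p) ≡ g ⊕ p) → Bounded Γ (fold xs a b)
  linearFoldᵇ {g = g} XS A B grows =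
    foldᵇ XS A g B (λ s p → ≤-reflexive (cong (_at s) (grows p)))

-- The reduction as a program

v₀ : ∀ {n} → Term (1 + n)
v₀ = var zero

v₁ : ∀ {n} → Term (2 + n)
v₁ = var (suc zero)

v₂ : ∀ {n} → Term (3 + n)
v₂ = var (suc (suc zero))

v₃ : ∀ {n} → Term (4 + n)
v₃ = var (suc (suc (suc zero)))

trueT : ∀ {n} → Term n
trueT = cons nil nil

notT : ∀ {n} → Term n → Term n
notT a = cond a nil trueT

monusT equalℕT equalBoolT equalLiteralT memberT adjacentT : ∀ {n} → Term n → Term n → Term n
monusT a b        = fold b a (tl v₁)
equalℕT a b       = cond (monusT a b) nil (notT (monusT b a))
equalBoolT a b    = cond a (cond b trueT nil) (notT b)
equalLiteralT a b = cond (equalℕT (hd a) (hd b)) (equalBoolT (tl a) (tl b)) nil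
memberT a c       = cond (equalLiteralT a (hd c)) trueT
                   (cond (equalLiteralT a (hd (tl c))) trueT
                   (cond (equalLiteralT a (hd (tl (tl c)))) trueT nil))
adjacentT u w     = cond (hd u)
                      (cond (hd w) nil (memberT (tl w) (tl u)))
                      (cond (hd w) (memberT (tl u) (tl w)) (notT (equalLiteralT (tl u) (tl w))))

tautologyT : ∀ {n} → Term n → Term n
tautologyT i = cons (cons i trueT) (cons (cons i trueT) (cons (cons i nil) nil))

-- The suffixes of a unary number are the smaller numbers, so the fold along 1 + n lists n, ..., 0:
-- all variables, with n as the dummy.
numbersT : Term 1
numbersT = fold (cons nil (hd v₀)) nil (cons (tl v₀) v₁)

clausesT : Term 2
clausesT = fold v₀ (tl v₁) (cons (tautologyT (hd v₀)) v₁)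

literalsBody : ∀ {n} → Term (2 + n)
literalsBody = cons (cons nil (cons (hd v₀) trueT)) (cons (cons nil (cons (hd v₀) nil)) v₁)

copiesT verticesT : Term 3
-- The list n, ..., 0 is extended by the successor of its head, which gives n + 2 copy indices.
copiesT   = fold (cons (cons nil (hd v₁)) v₁) nil (fold v₂ v₁ (cons (cons trueT (hd v₀)) v₁))
verticesT = fold v₁ copiesT literalsBody

matrixT : Term 4
matrixT = fold v₀ nil (cons (fold v₂ nil (cons (adjacentT (hd v₂) (hd v₀)) v₁)) v₁)

reductionT : Term 1
-- `v₃` is the input with head n, so the last component is k = n + 1.
reductionT = bind numbersT (bind clausesT (bind verticesT (cons matrixT (cons nil (hd v₃)))))

module _ {n} {Γ : Vec Poly n} where

  trueᵇ : Bounded Γ trueT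
  trueᵇ = consᵇ nilᵇ nilᵇ

  notᵇ : ∀ {a} → Bounded Γ a → Bounded Γ (notT a)
  notᵇ A = ifᵇ A nilᵇ trueᵇ

  module _ {a b} (A : Bounded Γ a) (B : Bounded Γ b) where

    monusᵇ : Bounded Γ (monusT a b)
    monusᵇ = foldᵇ B A (con 0) (λ _ → tlᵇ (varᵇ (suc zero))) (λ _ _ → ≤-refl)

  module _ {a b} (A : Bounded Γ a) (B : Bounded Γ b) where

    equalℕᵇ : Bounded Γ (equalℕT a b)
    equalℕᵇ = ifᵇ (monusᵇ A B) nilᵇ (notᵇ (monusᵇ B A))

    equalBoolᵇ : Bounded Γ (equalBoolT a b)
    equalBoolᵇ = ifᵇ A (ifᵇ B trueᵇ nilᵇ) (notᵇ B)

  equalLiteralᵇ : ∀ {a b} → Bounded Γ a → Bounded Γ b → Bounded Γ (equalLiteralT a b)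
  equalLiteralᵇ A B = ifᵇ (equalℕᵇ (hdᵇ A) (hdᵇ B)) (equalBoolᵇ (tlᵇ A) (tlᵇ B)) nilᵇ

  memberᵇ : ∀ {a c} → Bounded Γ a → Bounded Γ c → Bounded Γ (memberT a c)
  memberᵇ A C = ifᵇ (equalLiteralᵇ A (hdᵇ C)) trueᵇ
               (ifᵇ (equalLiteralᵇ A (hdᵇ (tlᵇ C))) trueᵇ
               (ifᵇ (equalLiteralᵇ A (hdᵇ (tlᵇ (tlᵇ C)))) trueᵇ nilᵇ))

  adjacentᵇ : ∀ {u w} → Bounded Γ u → Bounded Γ w → Bounded Γ (adjacentT u w)
  adjacentᵇ U W = ifᵇ (hdᵇ U)
                   (ifᵇ (hdᵇ W) nilᵇ (memberᵇ (tlᵇ W) (tlᵇ U)))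
                   (ifᵇ (hdᵇ W) (memberᵇ (tlᵇ U) (tlᵇ W)) (notᵇ (equalLiteralᵇ (tlᵇ U) (tlᵇ W))))

  tautologyᵇ : ∀ {i} → Bounded Γ i → Bounded Γ (tautologyT i)
  tautologyᵇ I = consᵇ (consᵇ I trueᵇ) (consᵇ (consᵇ I trueᵇ) (consᵇ (consᵇ I nilᵇ) nilᵇ))

numbersᵇ : Bounded (X ∷ []) numbersT
numbersᵇ = linearFoldᵇ (consᵇ nilᵇ (hdᵇ (varᵇ zero))) nilᵇ
  (λ _ → consᵇ (tlᵇ (varᵇ zero)) (varᵇ (suc zero))) (λ _ → refl)

module _ {p q : Poly} where

  clausesᵇ : Bounded (p ∷ q ∷ []) clausesT
  clausesᵇ = linearFoldᵇ (varᵇ zero) (tlᵇ (varᵇ (suc zero)))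
    (λ _ → consᵇ (tautologyᵇ (hdᵇ (varᵇ zero))) (varᵇ (suc zero))) (λ _ → refl)

module _ {p q r : Poly} where

  copiesᵇ : Bounded (p ∷ q ∷ r ∷ []) copiesT
  copiesᵇ = linearFoldᵇ (consᵇ (consᵇ nilᵇ (hdᵇ (varᵇ (suc zero)))) (varᵇ (suc zero))) nilᵇ
    (λ _ → linearFoldᵇ (varᵇ (suc (suc zero))) (varᵇ (suc zero))
      (λ _ → consᵇ (consᵇ trueᵇ (hdᵇ (varᵇ zero))) (varᵇ (suc zero))) (λ _ → refl))
    (λ _ → refl)

  verticesᵇ : Bounded (p ∷ q ∷ r ∷ []) verticesT
  verticesᵇ = foldᵇ (varᵇ (suc zero)) copiesᵇ
    (con 1 ⊕ sizeBound {Γ = q ∷ []} (consᵇ nilᵇ (consᵇ (hdᵇ (varᵇ zero)) trueᵇ)) ⊕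
     (con 1 ⊕ sizeBound {Γ = q ∷ []} (consᵇ nilᵇ (consᵇ (hdᵇ (varᵇ zero)) nilᵇ))))
    (λ _ → consᵇ (consᵇ nilᵇ (consᵇ (hdᵇ (varᵇ zero)) trueᵇ))
          (consᵇ (consᵇ nilᵇ (consᵇ (hdᵇ (varᵇ zero)) nilᵇ)) (varᵇ (suc zero))))
    -- Two nested conses associate the sum the other way, so `linearFoldᵇ` does not apply.
    (λ s a → ≤-reflexive (sym (+-assoc (3 + (q at s + 1)) (3 + (q at s + 0)) (a at s))))

module _ {p q r t : Poly} where

  matrixᵇ : Bounded (p ∷ q ∷ r ∷ t ∷ []) matrixT
  matrixᵇ = linearFoldᵇ (varᵇ zero) nilᵇ
    (λ _ → consᵇ (linearFoldᵇ (varᵇ (suc (suc zero))) nilᵇ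
      (λ _ → consᵇ (adjacentᵇ (hdᵇ (varᵇ (suc (suc zero)))) (hdᵇ (varᵇ zero))) (varᵇ (suc zero)))
      (λ _ → refl)) (varᵇ (suc zero)))
    (λ _ → refl)

opaque

  reductionᵇ : Bounded (X ∷ []) reductionT
  reductionᵇ = bindᵇ numbersᵇ (bindᵇ clausesᵇ (bindᵇ verticesᵇ
    (consᵇ matrixᵇ (consᵇ nilᵇ (hdᵇ (varᵇ (suc (suc (suc zero)))))))))

-- Vertices and adjacency of the constructed graph

Lit : Set
Lit = ℕ × Bool

-- The index of a clause vertex tells its copies apart.

data Vertex : Set where
  literal : Lit → Vertex
  clause  : ℕ → Vec Lit 3 → Vertex

_≟ˡ_ : DecidableEquality Lit
(x , b) ≟ˡ (y , c) =
  map′ (λ (p , q) → cong₂ _,_ p q) (λ eq → cong proj₁ eq , cong proj₂ eq) (x ≟ y ×-dec b Bool.≟ c)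

_∈?ˡ_ : (l : Lit) (c : Vec Lit 3) → Dec (VecAny.Any (l ≡_) c)
l ∈?ˡ c = VecAny.any? (l ≟ˡ_) c

adjacentᵛ : Vertex → Vertex → Bool
adjacentᵛ (literal l)  (literal m)  = not (does (l ≟ˡ m))
adjacentᵛ (literal l)  (clause _ c) = does (l ∈?ˡ c)
adjacentᵛ (clause _ c) (literal l)  = does (l ∈?ˡ c)
adjacentᵛ (clause _ _) (clause _ _) = false

encodeLit : Lit → Tree
encodeLit (x , b) = encodeℕ x ∙ encodeBool b

encodeLits : Vec Lit 3 → Tree
encodeLits c = encodeList encodeLit (toList c)

-- The copy index is dropped: adjacency ignores it, and copies are still told apart by their
-- positions in the list.
encodeVertex : Vertex → Tree
encodeVertex (literal l)  = nil ∙ encodeLit l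
encodeVertex (clause _ c) = (nil ∙ nil) ∙ encodeLits c

-- The positive literal is repeated to fill the three places of a clause.
tautology : ℕ → Vec Lit 3
tautology i = (i , true) ∷ (i , true) ∷ (i , false) ∷ []

literalPair : ℕ → List Vertex
literalPair i = literal (i , true) ∷ literal (i , false) ∷ []

module Vertices (n : ℕ) (cs : List (Vec Lit 3)) where

  allClauses : List (Vec Lit 3)
  allClauses = map tautology (downFrom (1 + n)) ++ cs

  copy : ℕ → List Vertex
  copy j = map (clause j) allClauses

  copies vertices : List Vertex
  -- The trailing `[]` mirrors the initial accumulator of the fold in `copiesT`.
  copies   = concatMap copy (downFrom (2 + n)) ++ []
  vertices = concatMap literalPair (downFrom (1 + n)) ++ copies

-- The program computes the adjacency matrix

foldSpine-tail : ∀ x y → foldSpine (λ _ acc → tail acc) (encodeℕ x) (encodeℕ y) ≡ encodeℕ (x ∸ y)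
foldSpine-tail x zero    = refl
foldSpine-tail x (suc y) = begin
  tail (foldSpine (λ _ acc → tail acc) (encodeℕ x) (encodeℕ y)) ≡⟨ cong tail (foldSpine-tail x y) ⟩
  tail (encodeℕ (x ∸ y))                                        ≡⟨ tail-pred (x ∸ y) ⟩
  encodeℕ (pred (x ∸ y))                                        ≡⟨ cong encodeℕ (pred[m∸n]≡m∸[1+n] x y) ⟩
  encodeℕ (x ∸ suc y)                                           ∎
  where
  open ≡-Reasoning
  tail-pred : ∀ z → tail (encodeℕ z) ≡ encodeℕ (pred z)
  tail-pred zero    = refl
  tail-pred (suc z) = refl

choose-encodeBool : ∀ b {x y} → choose (encodeBool b) x y ≡ (if b then x else y)
choose-encodeBool true  = refl
choose-encodeBool false = refl

module _ {n} (ρ : Vec Tree n) where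

  _computes_ : Term n → Tree → Set
  a computes t = ⟦ a ⟧ ρ ≡ t

  notT-computes : ∀ {a b} → a computes encodeBool b → notT a computes encodeBool (not b)
  notT-computes {b = b} p rewrite p with b
  ... | true  = refl
  ... | false = refl

  ifT-computes : ∀ {c a b t x y} → c computes encodeBool t →
    a computes x → b computes y → cond c a b computes (if t then x else y)
  ifT-computes {t = t} p q r rewrite p | q | r = choose-encodeBool t

  -- Numbers are equal just when both truncated differences vanish; if they differ, the one that is
  -- positive decides the test.
  equalℕT-computes : ∀ {a b x y} → a computes encodeℕ x → b computes encodeℕ y →
    equalℕT a b computes encodeBool (does (x ≟ y))
  equalℕT-computes {x = x} {y} p q
    rewrite p | q | foldSpine-tail x y | foldSpine-tail y x with <-cmp x y
  ... | tri< x<y x≢y _ rewrite m≤n⇒m∸n≡0 (<⇒≤ x<y) | dec-false (x ≟ y) x≢y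
    with y ∸ x in eq
  ... | zero  = ⊥-elim (<⇒≱ x<y (m∸n≡0⇒m≤n eq))
  ... | suc _ = refl
  equalℕT-computes {x = x} {y} p q
      | tri≈ _ refl _ rewrite n∸n≡0 x | dec-true (x ≟ x) refl = refl
  equalℕT-computes {x = x} {y} p q
      | tri> _ x≢y y<x rewrite dec-false (x ≟ y) x≢y with x ∸ y in eq
  ... | zero  = ⊥-elim (<⇒≱ y<x (m∸n≡0⇒m≤n eq))
  ... | suc _ = refl

  equalBoolT-computes : ∀ {a b x y} → a computes encodeBool x → b computes encodeBool y →
    equalBoolT a b computes encodeBool (does (x Bool.≟ y))
  equalBoolT-computes {x = true}  {true}  p q rewrite p | q = refl
  equalBoolT-computes {x = true}  {false} p q rewrite p | q = refl
  equalBoolT-computes {x = false} {true}  p q rewrite p | q = refl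
  equalBoolT-computes {x = false} {false} p q rewrite p | q = refl

  equalLiteralT-computes : ∀ {a b l m} → a computes encodeLit l → b computes encodeLit m →
    equalLiteralT a b computes encodeBool (does (l ≟ˡ m))
  equalLiteralT-computes {a} {b} {x , s} {y , t} p q = trans
    (ifT-computes {equalℕT (hd a) (hd b)} {equalBoolT (tl a) (tl b)} {nil} {does (x ≟ y)}
      (equalℕT-computes {hd a} {hd b} (cong head p) (cong head q))
      (equalBoolT-computes {tl a} {tl b} (cong tail p) (cong tail q)) refl)
    (conjunction (does (x ≟ y)))
    where
    conjunction : ∀ b {c} → (if b then encodeBool c else nil) ≡ encodeBool (b ∧ c)
    conjunction true  = refl
    conjunction false = refl

  memberT-computes : ∀ {a c l ls} → a computes encodeLit l → c computes encodeLits ls →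
    memberT a c computes encodeBool (does (l ∈?ˡ ls))
  memberT-computes {a} {c} {l} {x ∷ y ∷ z ∷ []} p q
    rewrite equalLiteralT-computes {a} {hd c} {l} {x} p (cong head q)
          | equalLiteralT-computes {a} {hd (tl c)} {l} {y} p (cong (λ t → head (tail t)) q)
          | equalLiteralT-computes {a} {hd (tl (tl c))} {l} {z} p (cong (λ t → head (tail (tail t))) q)
    with does (l ≟ˡ x) | does (l ≟ˡ y) | does (l ≟ˡ z)
  ... | true  | _     | _     = refl
  ... | false | true  | _     = refl
  ... | false | false | true  = refl
  ... | false | false | false = refl

  adjacentT-computes : ∀ {a b u w} → a computes encodeVertex u → b computes encodeVertex w →
    adjacentT a b computes encodeBool (adjacentᵛ u w)
  adjacentT-computes {a} {b} {literal l} {literal m} p q rewrite cong head p | cong head q =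
    notT-computes {equalLiteralT (tl a) (tl b)}
      (equalLiteralT-computes {tl a} {tl b} {l} {m} (cong tail p) (cong tail q))
  adjacentT-computes {a} {b} {literal l} {clause _ c} p q rewrite cong head p | cong head q =
    memberT-computes {tl a} {tl b} {l} {c} (cong tail p) (cong tail q)
  adjacentT-computes {a} {b} {clause _ c} {literal l} p q rewrite cong head p | cong head q =
    memberT-computes {tl b} {tl a} {l} {c} (cong tail q) (cong tail p)
  adjacentT-computes {a} {b} {clause _ _} {clause _ _} p q rewrite cong head p | cong head q = refl

bind-computes : ∀ {n} (ρ : Vec Tree n) a b {x y} →
  _computes_ ρ a x → _computes_ (x ∷ ρ) b y → _computes_ ρ (bind a b) y
bind-computes ρ a b refl q = q

module _ {A B : Set} {e : A → Tree} {e′ : B → Tree} {f : Tree → Tree → Tree} where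

  foldSpine-map : ∀ {g : A → B} → (∀ x t r → f (e x ∙ t) r ≡ e′ (g x) ∙ r) → ∀ xs ys →
    foldSpine f (encodeList e′ ys) (encodeList e xs) ≡ encodeList e′ (map g xs ++ ys)
  foldSpine-map step []       ys = refl
  foldSpine-map step (x ∷ xs) ys = trans (step x _ _) (cong (_ ∙_) (foldSpine-map step xs ys))

  foldSpine-concatMap : ∀ {g : A → List B} →
    (∀ x t zs → f (e x ∙ t) (encodeList e′ zs) ≡ encodeList e′ (g x ++ zs)) → ∀ xs ys →
    foldSpine f (encodeList e′ ys) (encodeList e xs) ≡ encodeList e′ (concatMap g xs ++ ys)
  foldSpine-concatMap     step []       ys = refl
  foldSpine-concatMap {g} step (x ∷ xs) ys = begin
    f (e x ∙ encodeList e xs) (foldSpine f (encodeList e′ ys) (encodeList e xs))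
      ≡⟨ cong (f _) (foldSpine-concatMap step xs ys) ⟩
    f (e x ∙ encodeList e xs) (encodeList e′ (concatMap g xs ++ ys))
      ≡⟨ step x _ _ ⟩
    encodeList e′ (g x ++ concatMap g xs ++ ys)
      ≡⟨ cong (encodeList e′) (++-assoc (g x) (concatMap g xs) ys) ⟨
    encodeList e′ ((g x ++ concatMap g xs) ++ ys) ∎
    where open ≡-Reasoning

foldSpine-encode : ∀ {A : Set} {e e′ : A → Tree} {f} → (∀ x t r → f (e x ∙ t) r ≡ e′ x ∙ r) → ∀ xs →
  foldSpine f nil (encodeList e xs) ≡ encodeList e′ xs
foldSpine-encode step []       = refl
foldSpine-encode step (x ∷ xs) = trans (step x _ _) (cong (_ ∙_) (foldSpine-encode step xs))

numbersT-computes : ∀ n t → _computes_ ((encodeℕ n ∙ t) ∷ []) numbersT (encodeList encodeℕ (downFrom (1 + n)))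
numbersT-computes n t = go n
  where
  go : ∀ m → foldSpine (λ x acc → tail x ∙ acc) nil (encodeℕ (1 + m)) ≡ encodeList encodeℕ (downFrom (1 + m))
  go zero    = refl
  go (suc m) = cong (encodeℕ (suc m) ∙_) (go m)

adjacencyMatrix : List Vertex → Tree
adjacencyMatrix ws = encodeList (λ u → encodeList (λ w → encodeBool (adjacentᵛ u w)) ws) ws

matrixT-computes : ∀ ws (ρ : Vec Tree 3) → _computes_ (encodeList encodeVertex ws ∷ ρ) matrixT (adjacencyMatrix ws)
matrixT-computes ws ρ = foldSpine-encode {e = encodeVertex}
  (λ u t r → cong (_∙ r) (foldSpine-encode {e = encodeVertex}
    (λ w t′ r′ → cong (_∙ r′) (adjacentT-computes
      ((encodeVertex w ∙ t′) ∷ r′ ∷ (encodeVertex u ∙ t) ∷ r ∷ encodeList encodeVertex ws ∷ ρ)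
      {hd v₂} {hd v₀} {u} {w} refl refl)) ws))
  ws

module _ (n : ℕ) (cs : List (Vec Lit 3)) where

  open Vertices n cs

  private
    input numbers : Tree
    input   = encodeℕ n ∙ encodeList encodeLits cs
    numbers = encodeList encodeℕ (downFrom (1 + n))

  clausesT-computes : _computes_ (numbers ∷ input ∷ []) clausesT (encodeList encodeLits allClauses)
  clausesT-computes = foldSpine-map {e = encodeℕ} {e′ = encodeLits}
    {f = λ x acc → ⟦ cons (tautologyT (hd v₀)) v₁ ⟧ (x ∷ acc ∷ numbers ∷ input ∷ [])} {g = tautology} (λ _ _ _ → refl) (downFrom (1 + n)) cs

  copiesT-computes : _computes_ (encodeList encodeLits allClauses ∷ numbers ∷ input ∷ []) copiesT
                                (encodeList encodeVertex copies)
  copiesT-computes = foldSpine-concatMap {e = encodeℕ} {e′ = encodeVertex}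
    {f = λ x acc → ⟦ fold v₂ v₁ (cons (cons trueT (hd v₀)) v₁) ⟧
                     (x ∷ acc ∷ encodeList encodeLits allClauses ∷ numbers ∷ input ∷ [])}
    {g = copy}
    (λ j _ zs → foldSpine-map {e = encodeLits} {e′ = encodeVertex}
      {f = λ x acc → ((nil ∙ nil) ∙ head x) ∙ acc} {g = clause j} (λ _ _ _ → refl) allClauses zs)
    (downFrom (2 + n)) []

  verticesT-computes : _computes_ (encodeList encodeLits allClauses ∷ numbers ∷ input ∷ []) verticesT
                                  (encodeList encodeVertex vertices)
  verticesT-computes = trans
    (cong (λ t → foldSpine literalsStep t numbers) copiesT-computes)
    (foldSpine-concatMap {e = encodeℕ} {e′ = encodeVertex} {f = literalsStep}
      {g = literalPair}
      (λ _ _ _ → refl) (downFrom (1 + n)) copies)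
    where
    literalsStep : Tree → Tree → Tree
    literalsStep x acc = ⟦ literalsBody ⟧
      (x ∷ acc ∷ encodeList encodeLits allClauses ∷ numbers ∷ input ∷ [])

  reductionT-computes : _computes_ (input ∷ []) reductionT (adjacencyMatrix vertices ∙ encodeℕ (1 + n))
  reductionT-computes =
    bind-computes (input ∷ []) numbersT (bind clausesT (bind verticesT result))
      (numbersT-computes n (encodeList encodeLits cs))
   (bind-computes (numbers ∷ input ∷ []) clausesT (bind verticesT result) clausesT-computes
   (bind-computes (encodeList encodeLits allClauses ∷ numbers ∷ input ∷ []) verticesT result verticesT-computes
   (cong₂ _∙_ (matrixT-computes vertices (encodeList encodeLits allClauses ∷ numbers ∷ input ∷ [])) refl)))
    where
    result : Term 4
    result = cons matrixT (cons nil (hd v₃))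

-- Correctness of the reduction

-- The number of elements of `P` before `x`. It injects `P` into `Fin ∣ P ∣`, which makes the
-- pigeonhole principle for `Fin` available for subsets.
rank : ∀ {n} (P : Subset n) {x} → x ∈ P → Fin ∣ P ∣
rank (inside  ∷ P) {zero}  x∈P              = zero
rank (inside  ∷ P) {suc x} (Vec.there x∈P) = suc (rank P x∈P)
rank (outside ∷ P) {suc x} (Vec.there x∈P) = rank P x∈P

rank-injective : ∀ {n} (P : Subset n) {x y} (x∈P : x ∈ P) (y∈P : y ∈ P) →
                 rank P x∈P ≡ rank P y∈P → x ≡ y
rank-injective (inside  ∷ P) {zero}  {zero}  _               _               _  = refl
rank-injective (inside  ∷ P) {suc _} {suc _} (Vec.there x∈P) (Vec.there y∈P) eq =
  cong suc (rank-injective P x∈P y∈P (Fin.suc-injective eq))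
rank-injective (inside  ∷ P) {zero}  {suc _} _               (Vec.there _)   ()
rank-injective (inside  ∷ P) {suc _} {zero}  (Vec.there _)   _               ()
rank-injective (outside ∷ P) {suc _} {suc _} (Vec.there x∈P) (Vec.there y∈P) eq =
  cong suc (rank-injective P x∈P y∈P eq)

injection⇒≤∣∣ : ∀ {m n} (P : Subset n) (h : Fin m → Fin n) → (∀ {i j} → h i ≡ h j → i ≡ j) →
                (∀ i → h i ∈ P) → m ≤ ∣ P ∣
injection⇒≤∣∣ P h h-injective h∈P =
  Fin.injective⇒≤ {f = λ i → rank P (h∈P i)} (λ eq → h-injective (rank-injective P (h∈P _) (h∈P _) eq))

∈-tabulate : ∀ {n} (p : Fin n → Bool) {v} → p v ≡ true → v ∈ tabulate p
∈-tabulate p {v} eq = lookup⇒[]= v _ (trans (lookup∘tabulate p v) eq)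

count : ∀ {A : Set} → (A → Bool) → List A → ℕ
count p []       = 0
count p (x ∷ xs) = (if p x then 1 else 0) + count p xs

count-++ : ∀ {A : Set} (p : A → Bool) xs {ys} → count p (xs ++ ys) ≡ count p xs + count p ys
count-++ p []       = refl
count-++ p (x ∷ xs) = trans (cong (_ +_) (count-++ p xs)) (sym (+-assoc (if p x then 1 else 0) _ _))

count-concatMap : ∀ {A B : Set} (p : A → Bool) (f : B → List A) {c} → (∀ x → count p (f x) ≡ c) →
                  ∀ xs → count p (concatMap f xs) ≡ length xs * c
count-concatMap p f eq []       = refl
count-concatMap p f eq (x ∷ xs) = trans (count-++ p (f x)) (cong₂ _+_ (eq x) (count-concatMap p f eq xs))

count-map-false : ∀ {A B : Set} (p : A → Bool) (f : B → A) → (∀ x → p (f x) ≡ false) →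
                  ∀ xs → count p (map f xs) ≡ 0
count-map-false p f eq []       = refl
count-map-false p f eq (x ∷ xs) rewrite eq x = count-map-false p f eq xs

∣tabulate∣ : ∀ {A : Set} (p : A → Bool) xs → ∣ tabulate (p ∘ List.lookup xs) ∣ ≡ count p xs
∣tabulate∣ p []       = refl
∣tabulate∣ p (x ∷ xs) with p x
... | true  = cong suc (∣tabulate∣ p xs)
... | false = ∣tabulate∣ p xs

encodeList-tabulate : ∀ {A B : Set} {n} {f : A → Tree} {g : B → Tree} {h : Fin n → A} {k : Fin n → B} →
  (∀ i → f (h i) ≡ g (k i)) → encodeList f (List.tabulate h) ≡ encodeList g (List.tabulate k)
encodeList-tabulate {n = zero}  eq = refl
encodeList-tabulate {n = suc _} eq = cong₂ _∙_ (eq zero) (encodeList-tabulate (eq ∘ suc))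

-- Neighborhoods, membership and minimum vertex covers

module GraphProperties (G : Graph) where

  open Graph G

  self∈N : ∀ v → v ∈ N[ v ]
  self∈N v = ∈-tabulate _ (cong (_∨ adjacent v v) (dec-true (v Fin.≟ v) refl))

  adjacent∈N : ∀ {u v} → adjacent u v ≡ true → v ∈ N[ u ]
  adjacent∈N {u} {v} uv = ∈-tabulate _ (trans (cong (does (v Fin.≟ u) ∨_) uv) (Bool.∨-zeroʳ _))

  M≤max : ∀ u S → M u S ≤ maxMembership S
  M≤max u S = All.lookup (xs≤max 0 (map (λ u → M u S) (allFin order))) (∈-map⁺ _ (∈-allFin u))

  -- Each neighborhood meets `S` in a part of `S`. Hence k true literals have membership at most k,
  -- whatever the edges.
  max≤∣∣ : ∀ S → maxMembership S ≤ ∣ S ∣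
  max≤∣∣ S = max≤v⁺ {xs = map (λ u → M u S) (allFin order)} z≤n (All.map⁺ (All.tabulate (λ {u} _ → ∣p∩q∣≤∣q∣ N[ u ] S)))

  -- A cover that is not minimum can be replaced by a smaller one, at most `b` times. The double
  -- negation spares a search through all subsets.
  ¬¬minimumVertexCover : ∀ b S → VertexCover S → ∣ S ∣ ≤ b →
    ¬ (∀ vc → vc ≤ b → ¬ MinimumVertexCoverSize vc)
  ¬¬minimumVertexCover zero    S cover S≤ none = none ∣ S ∣ S≤ ((S , cover , refl) , λ _ _ → ≤-trans S≤ z≤n)
  ¬¬minimumVertexCover (suc b) S cover S≤ none = none ∣ S ∣ S≤ ((S , cover , refl) , minimal)
    where
    minimal : ∀ S′ → VertexCover S′ → ∣ S ∣ ≤ ∣ S′ ∣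
    minimal S′ cover′ with ∣ S′ ∣ <? ∣ S ∣
    ... | no  S≮  = ≮⇒≥ S≮
    ... | yes S′< = ⊥-elim (¬¬minimumVertexCover b S′ cover′ (≤-pred (≤-trans S′< S≤))
                      (λ vc vc≤ → none vc (m≤n⇒m≤1+n vc≤)))

adjacentᵛ-sym : ∀ u v → adjacentᵛ u v ≡ adjacentᵛ v u
adjacentᵛ-sym (literal l)  (literal m)  = cong not (does-⇔ (mk⇔ sym sym) (l ≟ˡ m) (m ≟ˡ l))
adjacentᵛ-sym (literal _)  (clause _ _) = refl
adjacentᵛ-sym (clause _ _) (literal _)  = refl
adjacentᵛ-sym (clause _ _) (clause _ _) = refl

adjacentᵛ-irrefl : ∀ u → ¬ T (adjacentᵛ u u)
adjacentᵛ-irrefl (literal l) adj rewrite dec-true (l ≟ˡ l) refl = adj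

graphOf : List Vertex → Graph
graphOf ws = record
  { order    = length ws
  ; adjacent = λ u v → adjacentᵛ (List.lookup ws u) (List.lookup ws v)
  ; ~-sym    = λ {u} {v} → subst T (adjacentᵛ-sym (List.lookup ws u) (List.lookup ws v))
  ; ~-irrefl = λ { {u} refl → adjacentᵛ-irrefl (List.lookup ws u) }
  }

encodeGraph-graphOf : ∀ ws → encodeGraph (graphOf ws) ≡ adjacencyMatrix ws
encodeGraph-graphOf ws = trans
  (encodeList-tabulate {k = List.lookup ws} (λ u → trans
    (encodeList-tabulate {g = λ w → encodeBool (adjacentᵛ (List.lookup ws u) w)} {k = List.lookup ws} (λ _ → refl))
    (cong (encodeList _) (tabulate-lookup ws))))
  (cong (encodeList _) (tabulate-lookup ws))

-- A finite search, later made over the copies of a clause: either all lie in `S`, or one of them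
-- leads to a literal in `S`.
all-or : ∀ {m} {A : Fin m → Set} {B : Set} → (∀ i → A i ⊎ B) → (∀ i → A i) ⊎ B
all-or {zero}  f = inj₁ λ ()
all-or {suc m} f with f zero | all-or (f ∘ suc)
... | inj₂ b | _      = inj₂ b
... | inj₁ a | inj₂ b = inj₂ b
... | inj₁ a | inj₁ g = inj₁ λ { zero → a ; (suc i) → g i }

literal-injective : ∀ {l m} → literal l ≡ literal m → l ≡ m
literal-injective refl = refl

clause-injective : ∀ {i j c d} → clause i c ≡ clause j d → i ≡ j
clause-injective refl = refl

Satisfies : (ℕ → Bool) → Vec Lit 3 → Set
Satisfies ρ = VecAny.Any (λ (x , b) → ρ x ≡ b)

-- Membership and counting in the vertex list

module VertexMembership (n : ℕ) (cs : List (Vec Lit 3))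
                        (inRange : ∀ {c} → c ∈ˡ cs → ∀ {l} → l ∈ᵛ c → proj₁ l < 1 + n) where

  open Vertices n cs
  ∈allClauses-inRange : ∀ {c} → c ∈ˡ allClauses → ∀ {l} → l ∈ᵛ c → proj₁ l < 1 + n
  ∈allClauses-inRange c∈ l∈ with ∈-++⁻ (map tautology (downFrom (1 + n))) c∈
  ... | inj₂ c∈cs = inRange c∈cs l∈
  ... | inj₁ c∈taut with ∈-map⁻ tautology c∈taut
  ∈allClauses-inRange c∈ (VecAny.here refl)                             | inj₁ _ | i , i∈ , refl = ∈-downFrom⁻ i∈
  ∈allClauses-inRange c∈ (VecAny.there (VecAny.here refl))              | inj₁ _ | i , i∈ , refl = ∈-downFrom⁻ i∈
  ∈allClauses-inRange c∈ (VecAny.there (VecAny.there (VecAny.here refl))) | inj₁ _ | i , i∈ , refl = ∈-downFrom⁻ i∈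

  tautology∈ : ∀ {i} → i < 1 + n → tautology i ∈ˡ allClauses
  tautology∈ i< = ∈-++⁺ˡ (∈-map⁺ tautology (∈-downFrom⁺ i<))

  literal∈ : ∀ {i} b → i < 1 + n → literal (i , b) ∈ˡ vertices
  literal∈ b i< = ∈-++⁺ˡ (∈-concatMap⁺ literalPair (Any.map (λ { refl → pair b }) (∈-downFrom⁺ i<)))
    where
    pair : ∀ {i} b → literal (i , b) ∈ˡ literalPair i
    pair true  = here refl
    pair false = there (here refl)

  clause∈ : ∀ {j c} → j < 2 + n → c ∈ˡ allClauses → clause j c ∈ˡ vertices
  clause∈ j< c∈ = ∈-++⁺ʳ (concatMap literalPair (downFrom (1 + n)))
    (∈-++⁺ˡ (∈-concatMap⁺ copy (Any.map (λ { refl → ∈-map⁺ (clause _) c∈ }) (∈-downFrom⁺ j<))))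

  clause∈⁻ : ∀ {j c} → clause j c ∈ˡ vertices → c ∈ˡ allClauses
  clause∈⁻ {j} {c} v∈ with ∈-++⁻ (concatMap literalPair (downFrom (1 + n))) v∈
  ... | inj₁ v∈lits with satisfied (∈-concatMap⁻ literalPair {xs = downFrom (1 + n)} v∈lits)
  ...   | _ , here ()
  ...   | _ , there (here ())
  clause∈⁻ {j} {c} v∈ | inj₂ v∈copies
    with ∈-++⁻ (concatMap copy (downFrom (2 + n))) v∈copies
  ... | inj₁ v∈ with satisfied (∈-concatMap⁻ copy {xs = downFrom (2 + n)} v∈)
  ...   | _ , v∈map with ∈-map⁻ _ v∈map
  ...     | _ , c∈ , refl = c∈

  -- Only the `1 + n` literal pairs contribute. The value 2 of `c` gives the size of the vertex
  -- cover, the value 1 that of the dominating set.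
  count-vertices : ∀ (p : Vertex → Bool) c → (∀ j d → p (clause j d) ≡ false) →
    (∀ i → count p (literalPair i) ≡ c) →
    count p vertices ≡ (1 + n) * c
  count-vertices p c on-clause on-literals = begin
    count p vertices                        ≡⟨ count-++ p (concatMap literalPair (downFrom (1 + n))) ⟩
    count p (concatMap literalPair (downFrom (1 + n))) + count p copies
      ≡⟨ cong₂ _+_ (count-concatMap p literalPair on-literals (downFrom (1 + n))) no-clause ⟩
    length (downFrom (1 + n)) * c + 0       ≡⟨ +-identityʳ _ ⟩
    length (downFrom (1 + n)) * c           ≡⟨ cong (_* c) (length-downFrom (1 + n)) ⟩
    (1 + n) * c                             ∎
    where
    open ≡-Reasoning
    no-clause : count p copies ≡ 0
    no-clause = begin
      count p copies ≡⟨ count-++ p (concatMap copy (downFrom (2 + n))) ⟩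
      count p (concatMap copy (downFrom (2 + n))) + 0
        ≡⟨ cong (_+ 0) (count-concatMap p copy (λ j → count-map-false p (clause j) (on-clause j) allClauses) (downFrom (2 + n))) ⟩
      length (downFrom (2 + n)) * 0 + 0 ≡⟨ cong (_+ 0) (*-zeroʳ (length (downFrom (2 + n)))) ⟩
      0 ∎

-- The vertex list is a parameter so that it is not unfolded.

module Correctness (n : ℕ) (cs : List (Vec Lit 3))
                   (inRange : ∀ {c} → c ∈ˡ cs → ∀ {l} → l ∈ᵛ c → proj₁ l < 1 + n)
                   (ws : List Vertex) (ws≡ : ws ≡ Vertices.vertices n cs) where

  open Vertices n cs using (allClauses)
  open VertexMembership n cs inRange

  G : Graph
  G = graphOf ws
  open Graph G
  open GraphProperties G

  position : ∀ {w} → w ∈ˡ Vertices.vertices n cs → Σ[ v ∈ V ] List.lookup ws v ≡ w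
  position w∈ with subst (_ ∈ˡ_) (sym ws≡) w∈
  ... | w∈ws = index w∈ws , sym (lookup-index w∈ws)

  card-tabulate : ∀ (p : Vertex → Bool) c → (∀ j d → p (clause j d) ≡ false) →
    (∀ i → count p (literalPair i) ≡ c) → ∣ tabulate (p ∘ List.lookup ws) ∣ ≡ (1 + n) * c
  card-tabulate p c on-clause on-literals =
    trans (∣tabulate∣ p ws) (trans (cong (count p) ws≡) (count-vertices p c on-clause on-literals))

  isLiteral : Vertex → Bool
  isLiteral (literal _)  = true
  isLiteral (clause _ _) = false

  literals : Subset order
  literals = tabulate (isLiteral ∘ List.lookup ws)

  ∣literals∣ : ∣ literals ∣ ≡ (1 + n) * 2
  ∣literals∣ = card-tabulate isLiteral 2 (λ _ _ → refl) (λ _ → refl)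

  -- Clause vertices are pairwise non-adjacent, so the case of two of them is void.
  literals-cover : VertexCover literals
  literals-cover {u} {v} u~v with List.lookup ws u in equ | List.lookup ws v in eqv
  ... | literal _  | _         = inj₁ (∈-tabulate _ (cong isLiteral equ))
  ... | clause _ _ | literal _ = inj₂ (∈-tabulate _ (cong isLiteral eqv))

  -- From an assignment to a dominating set

  module _ (ρ : ℕ → Bool) where

    isTrue : Vertex → Bool
    isTrue (literal (x , b)) = does (ρ x Bool.≟ b)
    isTrue (clause _ _)      = false

    trueLiterals : Subset order
    trueLiterals = tabulate (isTrue ∘ List.lookup ws)

    ∣trueLiterals∣ : ∣ trueLiterals ∣ ≡ 1 + n
    ∣trueLiterals∣ = trans (card-tabulate isTrue 1 (λ _ _ → refl) one) (*-identityʳ (1 + n))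
      where
      one : ∀ i → count isTrue (literalPair i) ≡ 1
      one i with ρ i
      ... | true  = refl
      ... | false = refl

    true∈ : ∀ {v x b} → List.lookup ws v ≡ literal (x , b) → ρ x ≡ b → v ∈ trueLiterals
    true∈ {b = b} eq ρx = ∈-tabulate _ (trans (cong isTrue eq) (dec-true (_ Bool.≟ b) ρx))

    trueLiterals-dominating : (∀ {c} → c ∈ˡ cs → Satisfies ρ c) → Dominating trueLiterals
    trueLiterals-dominating sat v with List.lookup ws v in eqv
    -- Variable 0 exists even for n = 0, thanks to the dummy; its true literal dominates the whole
    -- clique.
    ... | literal l with l ≟ˡ (0 , ρ 0)
    ...   | yes refl = inj₁ (true∈ eqv refl)
    ...   | no  l≢   = let u , equ = position (literal∈ (ρ 0) (s≤s z≤n)) in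
      inj₂ (u , subst T (sym (cong (adjacentᵛ (literal l)) equ)) (subst (T ∘ not) (sym (dec-false (l ≟ˡ (0 , ρ 0)) l≢)) _) ,
            true∈ equ refl)
    trueLiterals-dominating sat v | clause j c =
      let l , l∈ , ρl = find (satisfied-by c∈)
          u , equ     = position (literal∈ (proj₂ l) (∈allClauses-inRange c∈ l∈)) in
      inj₂ (u , subst T (sym (trans (cong (adjacentᵛ (clause j c)) equ) (dec-true (l ∈?ˡ c) l∈))) _ , true∈ equ ρl)
      where
      c∈ : c ∈ˡ allClauses
      c∈ = clause∈⁻ (subst₂ _∈ˡ_ eqv ws≡ (∈-lookup v))
      either : ∀ i → Satisfies ρ (tautology i)
      either i with ρ i in eq
      ... | true  = VecAny.here eq
      ... | false = VecAny.there (VecAny.there (VecAny.here eq))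
      satisfied-by : ∀ {c} → c ∈ˡ allClauses → Satisfies ρ c
      satisfied-by c∈ with ∈-++⁻ (map tautology (downFrom (1 + n))) c∈
      ... | inj₂ c∈cs = sat c∈cs
      ... | inj₁ c∈taut with ∈-map⁻ tautology c∈taut
      ...   | i , _ , refl = either i

  -- From a dominating set to an assignment

  module _ (S : Subset order) (dominating : Dominating S) (max≤ : maxMembership S ≤ 1 + n) where

    Hits : Lit → Set
    Hits l = Σ[ u ∈ V ] u ∈ S × List.lookup ws u ≡ literal l

    -- Membership n + 2 exceeds k = n + 1. Both counting arguments end here: the one on the copies
    -- of a clause and the one on the clique of literals.
    crowded : ∀ u (h : Fin (2 + n) → V) → (∀ {i j} → h i ≡ h j → i ≡ j) → (∀ i → h i ∈ N[ u ]) →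
              (∀ i → h i ∈ S) → ⊥
    crowded u h h-injective h∈N h∈S = <-irrefl refl
      (≤-trans (injection⇒≤∣∣ (N[ u ] ∩ S) h h-injective (λ i → x∈p∩q⁺ (h∈N i , h∈S i)))
        (≤-trans (M≤max u S) max≤))

    copyAt : ∀ {c} → c ∈ˡ allClauses → (j : Fin (2 + n)) → Σ[ v ∈ V ] List.lookup ws v ≡ clause (toℕ j) c
    copyAt c∈ j = position (clause∈ (Fin.toℕ<n j) c∈)

    -- Otherwise all n + 2 copies of the clause would lie in S, next to a
    -- common literal.
    hit : ∀ {c} → c ∈ˡ allClauses → Σ[ l ∈ Lit ] l ∈ᵛ c × Hits l
    hit {c@(l₀ ∷ _)} c∈ with all-or dominated
      where
      dominated : ∀ j → proj₁ (copyAt c∈ j) ∈ S ⊎ (Σ[ l ∈ Lit ] l ∈ᵛ c × Hits l)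
      dominated j with dominating (proj₁ (copyAt c∈ j))
      ... | inj₁ j∈S = inj₁ j∈S
      ... | inj₂ (u , j~u , u∈S) with List.lookup ws u in equ | subst (λ w → T (adjacentᵛ w _)) (proj₂ (copyAt c∈ j)) j~u
      ...   | literal l | adj with l ∈?ˡ c
      ...     | yes l∈ = inj₂ (l , l∈ , u , u∈S , equ)
      ...     | no  l∉ = ⊥-elim (subst T (dec-false (l ∈?ˡ c) l∉) adj)
    ... | inj₂ found = found
    ... | inj₁ all∈S = ⊥-elim (crowded (proj₁ u) (proj₁ ∘ copyAt c∈)
        (λ {i} {j} eq → Fin.toℕ-injective (clause-injective
          (trans (sym (proj₂ (copyAt c∈ i))) (trans (cong (List.lookup ws) eq) (proj₂ (copyAt c∈ j))))))
        (λ j → adjacent∈N (trans (cong₂ adjacentᵛ (proj₂ u) (proj₂ (copyAt c∈ j))) (dec-true (l₀ ∈?ˡ c) (VecAny.here refl))))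
        all∈S)
      where
      u : Σ[ v ∈ V ] List.lookup ws v ≡ literal l₀
      u = position (literal∈ _ (∈allClauses-inRange c∈ (VecAny.here refl)))

    chosen : ∀ {x} → x < 1 + n → Σ[ b ∈ Bool ] Hits (x , b)
    chosen x< with hit (tautology∈ x<)
    ... | _ , VecAny.here refl                               , h = true , h
    ... | _ , VecAny.there (VecAny.here refl)                , h = true , h
    ... | _ , VecAny.there (VecAny.there (VecAny.here refl)) , h = false , h

    assignment : ℕ → Bool
    assignment x with x <? 1 + n
    ... | yes x< = proj₁ (chosen x<)
    -- An arbitrary default: all variables of the clauses lie below `1 + n`.
    ... | no  _  = true

    assignment-hits : ∀ {x} → x < 1 + n → Hits (x , assignment x)
    assignment-hits {x} x< with x <? 1 + n
    ... | yes x<′ = proj₂ (chosen x<′)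
    ... | no  x≮  = ⊥-elim (x≮ x<)

    -- The literals form a clique, so S contains at most n + 1 of them: it
    -- already has one for each variable and no room for a false one.
    hit-true : ∀ {x b} → Hits (x , b) → assignment x ≡ b
    hit-true {x} {b} (u , u∈S , equ) with assignment x Bool.≟ b
    ... | yes eq = eq
    ... | no  ≢b = ⊥-elim (crowded u h h-injective h∈N h∈S)
      where
      hits : (i : Fin (1 + n)) → Hits (toℕ i , assignment (toℕ i))
      hits i = assignment-hits (Fin.toℕ<n i)
      h : Fin (2 + n) → V
      h zero    = u
      h (suc i) = proj₁ (hits i)
      value : Fin (2 + n) → Lit
      value zero    = x , b
      value (suc i) = toℕ i , assignment (toℕ i)
      h-value : ∀ i → List.lookup ws (h i) ≡ literal (value i)
      h-value zero    = equ
      h-value (suc i) = proj₂ (proj₂ (hits i))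
      new : ∀ i → (x , b) ≢ value (suc i)
      new i refl = ≢b refl
      value-injective : ∀ i j → value i ≡ value j → i ≡ j
      value-injective zero    zero    eq = refl
      value-injective zero    (suc j) eq = ⊥-elim (new j eq)
      value-injective (suc i) zero    eq = ⊥-elim (new i (sym eq))
      value-injective (suc i) (suc j) eq = cong suc (Fin.toℕ-injective (cong proj₁ eq))
      h-injective : ∀ {i j} → h i ≡ h j → i ≡ j
      h-injective {i} {j} eq = value-injective i j (literal-injective
        (trans (sym (h-value i)) (trans (cong (List.lookup ws) eq) (h-value j))))
      h∈N : ∀ i → h i ∈ N[ u ]
      h∈N zero    = self∈N u
      h∈N (suc i) = adjacent∈N (trans (cong₂ adjacentᵛ equ (h-value (suc i)))
                      (cong not (dec-false ((x , b) ≟ˡ value (suc i)) (new i))))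
      h∈S : ∀ i → h i ∈ S
      h∈S zero    = u∈S
      h∈S (suc i) = proj₁ (proj₂ (hits i))

    assignment-satisfies : ∀ {c} → c ∈ˡ cs → Satisfies assignment c
    assignment-satisfies c∈ =
      let l , l∈ , h = hit (∈-++⁺ʳ (map tautology (downFrom (1 + n))) c∈) in
      VecAny.map (λ { refl → hit-true h }) l∈

-- Sublinear functions

maxUpTo : (ℕ → ℕ) → ℕ → ℕ
maxUpTo f zero    = f 0
maxUpTo f (suc m) = f (suc m) ⊔ maxUpTo f m

≤maxUpTo : ∀ f {i m} → i ≤ m → f i ≤ maxUpTo f m
≤maxUpTo f {m = zero}  z≤n = ≤-refl
≤maxUpTo f {m = suc m} i≤ with m≤n⇒m<n∨m≡n i≤
... | inj₁ (s≤s i≤m) = ≤-trans (≤maxUpTo f i≤m) (m≤n⊔m _ _)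
... | inj₂ refl      = m≤m⊔n _ _

maxUpTo-elim : ∀ (P : ℕ → Set) f m → (∀ i → i ≤ m → P (f i)) → P (maxUpTo f m)
maxUpTo-elim P f zero    p = p 0 z≤n
maxUpTo-elim P f (suc m) p with ⊔-sel (f (suc m)) (maxUpTo f m)
... | inj₁ eq = subst P (sym eq) (p (suc m) ≤-refl)
... | inj₂ eq = subst P (sym eq) (maxUpTo-elim P f m (λ i i≤ → p i (m≤n⇒m≤1+n i≤)))

-- Values of `f` below its threshold `N` are bounded by a constant, which a large `n` absorbs.
-- Beyond `N`, the argument is at most 2(1 + n) ≤ 4n, whence the factor 4 in `sub (4 * c)`.
sublinear-max : ∀ {f} → Sublinear f → Sublinear (λ n → maxUpTo f ((1 + n) * 2))
sublinear-max {f} sub c with sub (4 * c)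
... | N , small = suc (c * maxUpTo f N) , λ n n≥ →
  maxUpTo-elim (λ v → c * v ≤ n) f ((1 + n) * 2) (λ i → bound n n≥ i (N ≤? i))
  where
  open ≤-Reasoning
  bound : ∀ n → suc (c * maxUpTo f N) ≤ n → ∀ i → Dec (N ≤ i) → i ≤ (1 + n) * 2 → c * f i ≤ n
  bound n n≥ i (no N≰i) i≤ = ≤-trans (*-monoʳ-≤ c (≤maxUpTo f (<⇒≤ (≰⇒> N≰i)))) (<⇒≤ n≥)
  bound n n≥ i (yes N≤i) i≤ = *-cancelˡ-≤ 4 (begin
    4 * (c * f i) ≡⟨ *-assoc 4 c (f i) ⟨
    4 * c * f i   ≤⟨ small i N≤i ⟩
    i             ≤⟨ i≤ ⟩
    (1 + n) * 2   ≤⟨ *-monoˡ-≤ 2 (+-monoˡ-≤ n (≤-trans (s≤s z≤n) n≥)) ⟩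
    (n + n) * 2   ≡⟨ solve 1 (λ n → (n :+ n) :* con 2 := con 4 :* n) refl n ⟩
    4 * n         ∎)
    where open +-*-Solver

sublinear-+ : ∀ {f g} → Sublinear f → Sublinear g → Sublinear (λ n → f n + g n)
sublinear-+ {f} {g} sf sg c with sf (2 * c) | sg (2 * c)
... | N₁ , small₁ | N₂ , small₂ = N₁ + N₂ , λ n n≥ → *-cancelˡ-≤ 2 (begin
  2 * (c * (f n + g n))         ≡⟨ *-assoc 2 c (f n + g n) ⟨
  2 * c * (f n + g n)           ≡⟨ *-distribˡ-+ (2 * c) (f n) (g n) ⟩
  2 * c * f n + 2 * c * g n     ≤⟨ +-mono-≤ (small₁ n (≤-trans (m≤m+n N₁ N₂) n≥)) (small₂ n (≤-trans (m≤n+m N₂ N₁) n≥)) ⟩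
  n + n                         ≡⟨ cong (n +_) (+-identityʳ n) ⟨
  2 * n                         ∎)
  where open ≤-Reasoning

sublinear-* : ∀ {f} d → Sublinear f → Sublinear (λ n → d * f n)
sublinear-* {f} d sf c with sf (c * d)
... | N , small = N , λ n n≥ → ≤-trans (≤-reflexive (sym (*-assoc c d (f n)))) (small n n≥)

-- The binary logarithm of `suc n`, rounded up. It increases just when `suc n` equals `2 ^ l`, and
-- doubling then respects the upper bound.
logarithm : ∀ n → ∃[ l ] suc n ≤ 2 ^ l × 2 ^ l ≤ 1 + 2 * n
logarithm zero = 0 , ≤-refl , ≤-refl
logarithm (suc n) with logarithm n
... | l , lower , upper with suc n <? 2 ^ l
...   | yes fits = l , fits , ≤-trans upper (s≤s (*-monoʳ-≤ 2 (n≤1+n n)))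
...   | no  full with ≤-antisym lower (≮⇒≥ full)
...     | eq = suc l ,
  ≤-trans (+-mono-≤ (s≤s z≤n) ≤-refl) (≤-reflexive (trans (cong (suc n +_) (sym (+-identityʳ _))) (cong (2 *_) eq))) ,
  ≤-trans (≤-reflexive (cong (2 *_) (sym eq))) (n≤1+n _)

-- Shifted so that `2 ^ log n` dominates `2 + n`, the base of the polynomial bounds.
log : ℕ → ℕ
log n = proj₁ (logarithm (suc n))

-- While a ≤ 2^x, the new summand a is paid for by the doubling of the power; otherwise x < 2^x < a,
-- and the square suffices.
linear≤exponential : ∀ a x → a * x ≤ 2 ^ x + a * a
linear≤exponential a zero    = ≤-trans (≤-reflexive (*-zeroʳ a)) z≤n
linear≤exponential a (suc x) with a ≤? 2 ^ x
... | yes a≤ = begin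
  a * suc x                   ≡⟨ *-suc a x ⟩
  a + a * x                   ≤⟨ +-mono-≤ a≤ (linear≤exponential a x) ⟩
  2 ^ x + (2 ^ x + a * a)     ≡⟨ +-assoc (2 ^ x) (2 ^ x) (a * a) ⟨
  2 ^ x + 2 ^ x + a * a       ≡⟨ cong (λ v → 2 ^ x + v + a * a) (+-identityʳ (2 ^ x)) ⟨
  2 ^ suc x + a * a           ∎
  where open ≤-Reasoning
... | no  a≰ = ≤-trans (*-monoʳ-≤ a (≤-trans (s≤s (n≤2^n x)) (≰⇒> a≰))) (m≤n+m _ _)

-- Since 2 ^ `log n` is at most 2n + 3, the factor 4 leaves room for the remaining constants once n
-- passes the threshold.
sublinear-log : Sublinear log
sublinear-log c = 3 + 4 * c * (4 * c) , λ n n≥ → *-cancelˡ-≤ 4 (begin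
  4 * (c * log n)                       ≡⟨ *-assoc 4 c (log n) ⟨
  4 * c * log n                         ≤⟨ linear≤exponential (4 * c) (log n) ⟩
  2 ^ log n + 4 * c * (4 * c)           ≤⟨ +-monoˡ-≤ (4 * c * (4 * c)) (proj₂ (proj₂ (logarithm (suc n)))) ⟩
  1 + 2 * suc n + 4 * c * (4 * c)       ≡⟨ shuffle n (4 * c * (4 * c)) ⟩
  2 * n + (3 + 4 * c * (4 * c))         ≤⟨ +-monoʳ-≤ (2 * n) n≥ ⟩
  2 * n + n                             ≤⟨ +-monoʳ-≤ (2 * n) (m≤m+n n _) ⟩
  2 * n + 2 * n                         ≡⟨ *-distribʳ-+ n 2 2 ⟨
  4 * n                                 ∎)
  where
  open ≤-Reasoning
  shuffle : ∀ n k → 1 + 2 * suc n + k ≡ 2 * n + (3 + k)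
  shuffle = solve 2 (λ n k → con 1 :+ con 2 :* (con 1 :+ n) :+ k := con 2 :* n :+ (con 3 :+ k)) refl
    where open +-*-Solver

2+n≤2^log : ∀ n → 2 + n ≤ 2 ^ log n
2+n≤2^log n = proj₁ (proj₂ (logarithm (suc n)))

-- Encoded size of a formula

lookup-injective : ∀ {A : Set} {xs : List A} → Unique xs → ∀ {i j} → List.lookup xs i ≡ List.lookup xs j → i ≡ j
lookup-injective (_  ∷ _)      {zero}  {zero}  eq = refl
lookup-injective (x∉ ∷ _)      {zero}  {suc j} eq = ⊥-elim (All.lookup x∉ (∈-lookup j) eq)
lookup-injective (x∉ ∷ _)      {suc i} {zero}  eq = ⊥-elim (All.lookup x∉ (∈-lookup i) (sym eq))
lookup-injective (_  ∷ unique) {suc i} {suc j} eq = cong suc (lookup-injective unique eq)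

literalIndex : ∀ {n} → Literal n → Fin (n * 2)
literalIndex (x , false) = combine x zero
literalIndex (x , true)  = combine x (suc zero)

literalIndex-injective : ∀ {n} (l m : Literal n) → literalIndex l ≡ literalIndex m → l ≡ m
literalIndex-injective (x , false) (y , false) eq = cong (_, false) (Fin.combine-injectiveˡ x _ y _ eq)
literalIndex-injective (x , true)  (y , true)  eq = cong (_, true) (Fin.combine-injectiveˡ x _ y _ eq)
literalIndex-injective (x , false) (y , true)  eq with Fin.combine-injectiveʳ x zero y (suc zero) eq
... | ()
literalIndex-injective (x , true)  (y , false) eq with Fin.combine-injectiveʳ x (suc zero) y zero eq
... | ()

clauseIndex : ∀ {n} → Clause n → Fin (n * 2 * (n * 2 * (n * 2)))
clauseIndex (k ∷ l ∷ m ∷ []) = combine (literalIndex k) (combine (literalIndex l) (literalIndex m))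

clauseIndex-injective : ∀ {n} (c d : Clause n) → clauseIndex c ≡ clauseIndex d → c ≡ d
clauseIndex-injective (k ∷ l ∷ m ∷ []) (k′ ∷ l′ ∷ m′ ∷ []) eq
  with Fin.combine-injective (literalIndex k) _ (literalIndex k′) _ eq
... | eq₁ , eq₂ with Fin.combine-injective (literalIndex l) _ (literalIndex l′) _ eq₂
... | eq₃ , eq₄
  rewrite literalIndex-injective k k′ eq₁ | literalIndex-injective l l′ eq₃ | literalIndex-injective m m′ eq₄ = refl

-- There are 2n literals, hence (2n)³ clauses. Distinctness thus makes the input size polynomial in
-- the number of variables.
unique-length : ∀ {n} {cs : List (Clause n)} → Unique cs → length cs ≤ n * 2 * (n * 2 * (n * 2))
unique-length {cs = cs} unique = Fin.injective⇒≤ {f = λ i → clauseIndex (List.lookup cs i)}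
  (λ eq → lookup-injective unique (clauseIndex-injective _ _ eq))

size-encodeList : ∀ {A : Set} {f : A → Tree} {b} → (∀ x → size (f x) ≤ b) → ∀ xs →
                  size (encodeList f xs) ≤ length xs * suc b
size-encodeList f≤ []       = z≤n
size-encodeList f≤ (x ∷ xs) = s≤s (+-mono-≤ (f≤ x) (size-encodeList f≤ xs))

length≤size-encodeList : ∀ {A : Set} {f : A → Tree} xs → length xs ≤ size (encodeList f xs)
length≤size-encodeList []       = z≤n
length≤size-encodeList (x ∷ xs) = s≤s (≤-trans (length≤size-encodeList xs) (m≤n+m _ _))

size-encodeℕ : ∀ n → size (encodeℕ n) ≡ n
size-encodeℕ zero    = refl
size-encodeℕ (suc n) = cong suc (size-encodeℕ n)

size-encodeBool : ∀ b → size (encodeBool b) ≤ 1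
size-encodeBool true  = ≤-refl
size-encodeBool false = z≤n

size-encodeLiteral : ∀ {n} (l : Literal n) → size (encodeLiteral l) ≤ suc (n + 1)
size-encodeLiteral (x , b) = s≤s (+-mono-≤
  (≤-trans (≤-reflexive (size-encodeℕ (toℕ x))) (<⇒≤ (Fin.toℕ<n x))) (size-encodeBool b))

size-encodeClause : ∀ {n} (c : Clause n) → size (encodeClause c) ≤ 3 * suc (suc (n + 1))
size-encodeClause {n} c = subst (λ k → size (encodeClause c) ≤ k * suc (suc (n + 1))) (Vec.length-toList c)
  (size-encodeList {f = encodeLiteral} size-encodeLiteral (toList c))

inputSize : Poly
inputSize = con 1 ⊕ (X ⊕ X ⊗ con 2 ⊗ (X ⊗ con 2 ⊗ (X ⊗ con 2)) ⊗ (con 1 ⊕ con 3 ⊗ (con 2 ⊕ (X ⊕ con 1))))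

size-encode3CNF : ∀ φ → size (encode3CNF φ) ≤ inputSize at 3CNF.variables φ
size-encode3CNF φ = s≤s (+-mono-≤ (≤-reflexive (size-encodeℕ variables))
  (≤-trans (size-encodeList size-encodeClause clauses) (*-monoˡ-≤ _ (unique-length distinct))))
  where open 3CNF φ

-- ETH counts variables, not input size, so two polynomial bounds are composed and their degrees
-- multiply. The 2 in `2 + b` comes from absorbing the summand 2 by `pow-sum`.
input-degree : ∀ p → ∃[ d ] ∀ φ → p at size (encode3CNF φ) ≤ (2 + 3CNF.variables φ) ^ d
input-degree p with degree-bound p | degree-bound inputSize
... | a , p≤ | b , input≤ = (2 + b) * a , λ φ →
  let n = 3CNF.variables φ in begin
  p at size (encode3CNF φ)           ≤⟨ p≤ _ ⟩
  (2 + size (encode3CNF φ)) ^ a      ≤⟨ ^-monoˡ-≤ a (+-mono-≤ (2≤2+n^1 n) (≤-trans (size-encode3CNF φ) (input≤ n))) ⟩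
  ((2 + n) ^ 1 + (2 + n) ^ b) ^ a    ≤⟨ ^-monoˡ-≤ a (pow-sum n 1 b) ⟩
  ((2 + n) ^ (2 + b)) ^ a            ≡⟨ ^-*-assoc (2 + n) (2 + b) a ⟩
  (2 + n) ^ ((2 + b) * a)            ∎
  where
  open ≤-Reasoning
  2≤2+n^1 : ∀ n → 2 ≤ (2 + n) ^ 1
  2≤2+n^1 n = ≤-trans (m≤m+n 2 n) (≤-reflexive (sym (*-identityʳ (2 + n))))

-- Running time of the reduction and the theorem

module Reduction (φ : 3CNF) where

  open 3CNF φ renaming (variables to n)

  toLits : Clause n → Vec Lit 3
  toLits = Vec.map (λ (x , b) → toℕ x , b)

  inRange : ∀ {c} → c ∈ˡ map toLits clauses → ∀ {l} → l ∈ᵛ c → proj₁ l < 1 + n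
  inRange c∈ l∈ with ∈-map⁻ toLits c∈
  ... | c , _ , refl with VecAny.satisfied (VecAny.map⁻ {xs = c} l∈)
  ... | (x , _) , refl = m≤n⇒m≤1+n (Fin.toℕ<n x)

  opaque

    ws : List Vertex
    ws = Vertices.vertices n (map toLits clauses)

    ws≡ : ws ≡ Vertices.vertices n (map toLits clauses)
    ws≡ = refl

  open Correctness n (map toLits clauses) inRange ws ws≡ public

  instanceOf : MMDSInstance
  instanceOf = record { graph = G ; k = 1 + n ; k>0 = s≤s z≤n }

  encode-clauses : ∀ cs → encodeList encodeClause cs ≡ encodeList encodeLits (map toLits cs)
  encode-clauses []                       = refl
  encode-clauses ((_ ∷ _ ∷ _ ∷ []) ∷ cs) = cong (_ ∙_) (encode-clauses cs)

  reductionT-instance : ⟦ reductionT ⟧ (encode3CNF φ ∷ []) ≡ encodeMMDS instanceOf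
  reductionT-instance = begin
    ⟦ reductionT ⟧ (encode3CNF φ ∷ [])
      ≡⟨ cong (λ t → ⟦ reductionT ⟧ ((encodeℕ n ∙ t) ∷ [])) (encode-clauses clauses) ⟩
    ⟦ reductionT ⟧ ((encodeℕ n ∙ encodeList encodeLits (map toLits clauses)) ∷ [])
      ≡⟨ reductionT-computes n (map toLits clauses) ⟩
    adjacencyMatrix (Vertices.vertices n (map toLits clauses)) ∙ encodeℕ (1 + n)
      ≡⟨ cong (λ vs → adjacencyMatrix vs ∙ encodeℕ (1 + n)) ws≡ ⟨
    adjacencyMatrix ws ∙ encodeℕ (1 + n)
      ≡⟨ cong (_∙ encodeℕ (1 + n)) (encodeGraph-graphOf ws) ⟨
    encodeMMDS instanceOf ∎
    where open ≡-Reasoning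

  -- The matrix has one row per vertex, so the size bound for the output of the program also bounds
  -- the order.
  order<size : Graph.order G < size (⟦ reductionT ⟧ (encode3CNF φ ∷ []))
  order<size = subst (λ t → length ws < size t)
    (sym (trans reductionT-instance (cong (_∙ encodeℕ (1 + n)) (encodeGraph-graphOf ws))))
    (s≤s (≤-trans (length≤size-encodeList ws) (m≤m+n _ _)))

  sound : HasMMDS instanceOf → Satisfiable φ
  sound (S , dominating , max≤) = assignment S dominating max≤ ∘ toℕ ,
    All.tabulate (λ {c} c∈ → VecAny.map⁻ {xs = c} (assignment-satisfies S dominating max≤ (∈-map⁺ toLits c∈)))

  extend : (Fin n → Bool) → ℕ → Bool
  extend ρ x with x <? n
  ... | yes x<n = ρ (fromℕ< x<n)
  -- This covers the dummy variable, whose value is arbitrary.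
  ... | no  _   = true

  extend-toℕ : ∀ ρ i → extend ρ (toℕ i) ≡ ρ i
  extend-toℕ ρ i with toℕ i <? n
  ... | yes i<n = cong ρ (Fin.fromℕ<-toℕ i i<n)
  ... | no  i≮n = ⊥-elim (i≮n (Fin.toℕ<n i))

  complete : Satisfiable φ → HasMMDS instanceOf
  complete (ρ , sat) = trueLiterals (extend ρ) , trueLiterals-dominating (extend ρ) satisfied-by ,
    ≤-trans (GraphProperties.max≤∣∣ G (trueLiterals (extend ρ))) (≤-reflexive (∣trueLiterals∣ (extend ρ)))
    where
    satisfied-by : ∀ {c} → c ∈ˡ map toLits clauses → Satisfies (extend ρ) c
    satisfied-by c∈ with ∈-map⁻ toLits c∈
    ... | c , c∈cs , refl = VecAny.map⁺ (VecAny.map (trans (extend-toℕ ρ _)) (All.lookup sat c∈cs))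

-- As a module parameter, it hides the concrete program and its large degrees from the final
-- calculation.
record PolynomialReduction : Set where
  field
    reducer : Command
    timeDegree orderDegree : ℕ
    order-bound : ∀ φ → suc (Graph.order (Reduction.G φ)) ≤ (2 + 3CNF.variables φ) ^ orderDegree
    composes : ∀ φ {C o t} → (Computes C ⟶ encodeMMDS (Reduction.instanceOf φ) In o) t →
      ∃[ u ] (Computes reducer ⨾ C ⟶ encode3CNF φ In o) (u + t) × u ≤ (2 + 3CNF.variables φ) ^ timeDegree

polynomialReduction : PolynomialReduction
polynomialReduction = record
  { reducer     = program reductionT
  ; timeDegree  = proj₁ timeBounded
  ; orderDegree = proj₁ sizeBounded
  ; order-bound = λ φ → ≤-trans (Reduction.order<size φ) (≤-trans (proj₁ (bounds φ)) (proj₂ sizeBounded φ))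
  ; composes    = λ φ computes →
      let u , computes′ , u≤ = compose reductionT (Reduction.reductionT-instance φ) computes in
      u , computes′ , ≤-trans u≤ (≤-trans (+-monoʳ-≤ 4 (+-monoˡ-≤ 2 (proj₂ (bounds φ)))) (proj₂ timeBounded φ))
  }
  where
  timeBounded : ∃[ d ] ∀ φ → (con 4 ⊕ (timeBound reductionᵇ ⊕ con 2)) at size (encode3CNF φ) ≤ (2 + 3CNF.variables φ) ^ d
  timeBounded = input-degree (con 4 ⊕ (timeBound reductionᵇ ⊕ con 2))

  sizeBounded : ∃[ d ] ∀ φ → sizeBound reductionᵇ at size (encode3CNF φ) ≤ (2 + 3CNF.variables φ) ^ d
  sizeBounded = input-degree (sizeBound reductionᵇ)

  bounds : ∀ φ → size (⟦ reductionT ⟧ (encode3CNF φ ∷ [])) ≤ sizeBound reductionᵇ at size (encode3CNF φ) ×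
                 time reductionT (encode3CNF φ ∷ []) ≤ timeBound reductionᵇ at size (encode3CNF φ)
  bounds φ = holds reductionᵇ (size (encode3CNF φ)) (encode3CNF φ ∷ []) λ { zero → ≤-refl }

module _ (R : PolynomialReduction) where

  open PolynomialReduction R

  3SAT-decider : ∀ {C f c} → Sublinear f → Decides MMDS C (VCTimeBound f c) →
    ∃[ g ] Sublinear g × Decides 3SAT (reducer ⨾ C) (λ φ t → t ≤ 2 ^ g (3CNF.variables φ))
  3SAT-decider {C} {f} {c} sublinear decides =
    exponent , sublinear-+ (sublinear-max sublinear) (sublinear-* d sublinear-log) , decide
    where
    d : ℕ
    -- The exponent that `pow-sum` yields for the time of the reduction plus the factor
    -- `suc order ^ c`.
    d = suc (timeDegree + orderDegree * c)

    F exponent : ℕ → ℕ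
    F n        = maxUpTo f ((1 + n) * 2)
    exponent n = F n + d * log n

    decide : Decides 3SAT (reducer ⨾ C) (λ φ t → t ≤ 2 ^ exponent (3CNF.variables φ))
    decide φ with decides (Reduction.instanceOf φ)
    ... | o , t , computes , t≤ , correct with composes φ computes
    ... | u , computes′ , u≤ =
      o , u + t , computes′ , total , mk⇔ (sound ∘ Equivalence.to correct) (Equivalence.from correct ∘ complete)
      where
      open Reduction φ
      open 3CNF φ renaming (variables to n)
      open Graph G using (order)
      open GraphProperties G
      open ≤-Reasoning

      t≤′ : t ≤ 2 ^ F n * suc order ^ c
      -- The time bound presupposes the minimum size of a vertex cover, which is at hand only under
      -- a double negation; decidability of the inequality removes it.
      t≤′ = decidable-stable (t ≤? 2 ^ F n * suc order ^ c) λ t≰ →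
        ¬¬minimumVertexCover ((1 + n) * 2) literals literals-cover (≤-reflexive ∣literals∣) λ vc vc≤ minimum →
          t≰ (≤-trans (t≤ vc minimum) (*-monoˡ-≤ (suc order ^ c) (^-monoʳ-≤ 2 (≤maxUpTo f vc≤))))

      total : u + t ≤ 2 ^ exponent n
      total = begin
        u + t
          ≤⟨ +-mono-≤ u≤ t≤′ ⟩
        (2 + n) ^ timeDegree + 2 ^ F n * suc order ^ c
          -- `2 ^ F n` is positive, so the reduction time may be multiplied by it to create a common
          -- factor.
          ≤⟨ +-mono-≤ (m≤n*m ((2 + n) ^ timeDegree) (2 ^ F n) {{m^n≢0 2 (F n)}})
               (*-monoʳ-≤ (2 ^ F n) (^-monoˡ-≤ c (order-bound φ))) ⟩
        2 ^ F n * (2 + n) ^ timeDegree + 2 ^ F n * ((2 + n) ^ orderDegree) ^ c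
          ≡⟨ cong (λ v → 2 ^ F n * (2 + n) ^ timeDegree + 2 ^ F n * v) (^-*-assoc (2 + n) orderDegree c) ⟩
        2 ^ F n * (2 + n) ^ timeDegree + 2 ^ F n * (2 + n) ^ (orderDegree * c)
          ≡⟨ *-distribˡ-+ (2 ^ F n) ((2 + n) ^ timeDegree) ((2 + n) ^ (orderDegree * c)) ⟨
        2 ^ F n * ((2 + n) ^ timeDegree + (2 + n) ^ (orderDegree * c))
          ≤⟨ *-monoʳ-≤ (2 ^ F n) (pow-sum n timeDegree (orderDegree * c)) ⟩
        2 ^ F n * (2 + n) ^ d
          ≤⟨ *-monoʳ-≤ (2 ^ F n) (^-monoˡ-≤ d (2+n≤2^log n)) ⟩
        2 ^ F n * (2 ^ log n) ^ d
          ≡⟨ cong (2 ^ F n *_) (trans (^-*-assoc 2 (log n) d) (cong (2 ^_) (*-comm (log n) d))) ⟩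
        2 ^ F n * 2 ^ (d * log n)
          ≡⟨ ^-distribˡ-+-* 2 (F n) (d * log n) ⟨
        2 ^ exponent n ∎

theorem5 : ETH →
    ¬ (∃[ C ] ∃[ f ] ∃[ c ] (Sublinear f × Decides MMDS C (VCTimeBound f c)))
theorem5 eth (C , f , c , sublinear , decides) =
  eth (PolynomialReduction.reducer polynomialReduction ⨾ C ,
       3SAT-decider polynomialReduction {c = c} sublinear decides)
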